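{- Let $q>2$ be a prime power, let $\mathbb{F}_q$ be the finite field with $q$ elements, let $t\in\mathbb{F}_q^*$, and let $f=\mathtt{x}^{q-2}+t\,\mathtt{x}^{q^2-q-1}\in\mathbb{F}_q[\mathtt{x}]$. Then $f$ is a permutation polynomial of $\mathbb{F}_{q^2}$ if and only if one of the following occurs: (i) $t=1$ and $q\equiv 1\pmod 4$; (ii) $t=-3$ and $q\equiv \pm 1\pmod{12}$; (iii) $t=3$ and $q\equiv -1\pmod 6$.
   Context: A polynomial $f$ with coefficients in a finite field $F$ is called a permutation polynomial of $F$ if the map $F\to F$, $x\mapsto f(x)$, is a permutation of $F$; here $f\in\mathbb{F}_q[\mathtt{x}]$ is viewed as a polynomial over $\mathbb{F}_{q^2}\supset\mathbb{F}_q$. The equalities $t=1$, $t=-3$, $t=3$ are in $\mathbb{F}_q$ (integers are read as their images in $\mathbb{F}_q$). -}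

module Defs where

open import Algebra.Bundles using (CommutativeRing; RawRing)
open import Algebra.Morphism.Structures using (module RingMorphisms)
open import Data.Fin.Base using (Fin)
open import Data.Integer.Base as ℤ using (ℤ; +_; -[1+_])
open import Data.Integer.Divisibility using (_∣_)
open import Data.List.Base using (List; []; _∷_; _++_; foldr; map; replicate)
open import Data.Nat.Base as ℕ using (ℕ; suc)
open import Data.Nat.Primality using (Prime)
open import Data.Product.Base using (∃-syntax; _×_)
open import Function.Bundles using (Inverse)
open import Function.Definitions using (Bijective)
open import Level using (Level; _⊔_) renaming (suc to lsuc)
open import Relation.Binary.PropositionalEquality using (_≡_; setoid)
open import Relation.Nullary.Negation.Core using (¬_)

import Algebra.Definitions.RawSemiring as RawSemiringDefs

private
  variable
    c ℓ c₁ ℓ₁ c₂ ℓ₂ : Level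

PrimePower : ℕ → Set
PrimePower q = ∃[ p ] ∃[ k ] Prime p × 1 ℕ.≤ k × q ≡ p ℕ.^ k

infix 4 _≡_[mod_]
_≡_[mod_] : ℤ → ℤ → ℤ → Set
a ≡ b [mod n ] = n ∣ a ℤ.- b

-- The library's HeytingField carries an apartness relation; here nonzero
-- means ¬ (x ≈ 0#).  For finite fields, where _≈_ is decidable, the two
-- notions agree.
record Field c ℓ : Set (lsuc (c ⊔ ℓ)) where
  field
    commutativeRing : CommutativeRing c ℓ

  open CommutativeRing commutativeRing public

  field
    1≉0     : ¬ (1# ≈ 0#)
    inverse : ∀ x → ¬ (x ≈ 0#) → ∃[ y ] x * y ≈ 1#

HasCardinality : Field c ℓ → ℕ → Set (c ⊔ ℓ)
HasCardinality F n = Inverse (Field.setoid F) (setoid (Fin n))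

IsFieldEmbedding : (F : Field c₁ ℓ₁) (K : Field c₂ ℓ₂) →
                   (Field.Carrier F → Field.Carrier K) → Set (c₁ ⊔ ℓ₁ ⊔ ℓ₂)
IsFieldEmbedding F K = IsRingMonomorphism
  where open RingMorphisms (Field.rawRing F) (Field.rawRing K)

-- In RawSemiringDefs, n × a is the n-fold sum a + ⋯ + a.
fromℤ : (F : Field c ℓ) → ℤ → Field.Carrier F
fromℤ F = λ where
    (+ n)    → n · 1#
    -[1+ n ] → - (suc n · 1#)
  where
  open Field F
  open RawSemiringDefs (RawRing.rawSemiring rawRing) using () renaming (_×_ to _·_)

-- Coefficient lists, constant term first.  Trailing zeros are allowed, so
-- different lists may represent the same polynomial.
Polynomial : Field c ℓ → Set c
Polynomial F = List (Field.Carrier F)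

module _ (F : Field c ℓ) where
  open Field F

  -- a xⁿ
  monomial : Carrier → ℕ → Polynomial F
  monomial a n = replicate n 0# ++ (a ∷ [])

  addPoly : Polynomial F → Polynomial F → Polynomial F
  addPoly []       g        = g
  addPoly f@(_ ∷ _) []      = f
  addPoly (a ∷ f)  (b ∷ g)  = (a + b) ∷ addPoly f g

  -- Horner's rule
  eval : Polynomial F → Carrier → Carrier
  eval f x = foldr (λ a r → a + x * r) 0# f

  IsPermutationPolynomial : Polynomial F → Set (c ⊔ ℓ)
  IsPermutationPolynomial f = Bijective _≈_ _≈_ (eval f)

extendScalars : (F : Field c₁ ℓ₁) (K : Field c₂ ℓ₂) →
                (Field.Carrier F → Field.Carrier K) → Polynomial F → Polynomial K
extendScalars F K ι = map ι

-- x^(q-2) + t x^(q²-q-1); both truncated subtractions are exact for q ≥ 2.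
binomial : (F : Field c ℓ) → ℕ → Field.Carrier F → Polynomial F
binomial F q t =
  addPoly F (monomial F (Field.1# F) (q ℕ.∸ 2))
            (monomial F t (q ℕ.^ 2 ℕ.∸ q ℕ.∸ 1))

{-# OPTIONS --safe #-}
module Submission where

-- Let y = x^(q-1) ∈ μ_{q+1}, on which φ : x ↦ x^q is inversion. Then
-- x f(x) = y + t/y for x ≠ 0, and f permutes K iff y² ≠ -t on μ_{q+1} and
-- y ↦ (1 + t y²)/(y³ + t y), which is f(x)^(q-1), permutes μ_{q+1}.
--
-- Necessity is Hermite's criterion for the exponent 2(q-1) alone. By partial
-- fractions in w = y², Σ f(x)^(2(q-1)) = 0 becomes a relation between
-- Σ 1/(w + t) and Σ 1/(w + t)². As w runs through the n-th roots of unity, with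
-- n = (q+1)/2 or, for even q, n = q+1, these sums are rational functions of t
-- and Y = (-t)^n. One gets Y ≠ 1, and for t² ≠ 1 that 2Y = n(t² - 1) + 2.
-- For even q this is absurd; for odd q it reads 4Y = t² + 3, and with Y² = t²
-- it forces t = ±3 and Y = 3, which determines (∓3)^((q-1)/2).
--
-- Conversely, if y ≠ z have the same image then E(t, y, z) = 0 for
-- E = t(y²z² + 1) + (1 - t²)yz + y² + z². It equals (y² + 1)(z² + 1) for t = 1 and
-- (y - z)² ± 3(yz ∓ 1)² for t = ±3, so that ∓3 would be the square of
-- (y - z)/(yz ∓ 1), which φ multiplies by ±1; this contradicts the value of
-- (∓3)^((q-1)/2).

open import Defs
open import Algebra.Bundles using (CommutativeMonoid)
open import Algebra.Morphism.Structures using (module RingMorphisms)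
import Algebra.Properties.CommutativeMonoid.Sum
import Algebra.Solver.Ring
open import Algebra.Solver.Ring.AlmostCommutativeRing
  using (fromCommutativeRing; _-Raw-AlmostCommutative⟶_)
open import Data.Empty using (⊥; ⊥-elim)
open import Data.Fin.Base as Fin
  using (Fin; zero; suc; toℕ; fromℕ; inject₁; inject≤; punchOut)
open import Data.Fin.Permutation using (Permutation; permutation)
import Data.Fin.Properties as Finₚ
open import Data.Integer.Base as ℤ using (ℤ; +_; -[1+_])
import Data.Integer.Properties as ℤₚ
open import Data.List.Base using ([]; _∷_; map)
open import Data.Maybe.Base using (just; nothing)
open import Data.Nat.Base as ℕ using (ℕ; zero; suc; s≤s; z≤n; _>_)
open import Data.Nat.Combinatorics using (_C_; nCn≡1; nCk≡n!/k![n-k]!; k![n∸k]!∣n!)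
import Data.Nat.DivMod as ℕᵈ
open import Data.Nat.Divisibility using (_∣_; divides; ∣⇒≤; m∣m*n; ∣1⇒≡1)
open import Data.Nat.LCM using (lcm-least)
open import Data.Nat.Primality
  using (Prime; prime?; prime[2]; euclidsLemma; prime⇒nonZero; prime⇒nonTrivial; prime⇒irreducible)
import Data.Nat.Properties as ℕₚ
open import Data.Nat.Solver using (module +-*-Solver)
open import Data.Product.Base using (_×_; _,_; proj₁; proj₂; ∃-syntax)
open import Data.Sum.Base using (_⊎_; inj₁; inj₂; [_,_]′) renaming (map to ⊎-map)
open import Data.Vec.Base as Vec using (Vec; []; _∷_)
open import Function.Base using (_∘_; id)
open import Function.Bundles using (Inverse; _⇔_; mk⇔)
open import Function.Definitions using (Bijective; Injective)
open import Level using (Level)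
open import Relation.Binary.Definitions using (Decidable; WeaklyDecidable)
open import Relation.Binary.PropositionalEquality.Core as ≡ using (_≡_; _≢_)
open import Relation.Nullary using (¬_; Dec; yes; no; contradiction; ¬?)
open import Relation.Nullary.Decidable using (map′; decidable-stable; toWitness)

-- For nonzero c in the subfield with q elements, f(c x) = f(x)/c, so the sums of f(x)^s with q - 1
-- not dividing s vanish for every t. For odd q the exponent q - 1 gives nothing either, as
-- f(x)^(q-1) is an odd function of y. Hence the exponent 2(q - 1), for which only w enters:
-- f(x)^(2(q-1)) = (1 + t w)²/(w (w + t)²). The sums run over all of K, weighted by x^(q²-1), and
-- not over roots of unity. This makes the cyclicity of the multiplicative group dispensable: a
-- power sum of w vanishes as soon as the substitution of b x for x multiplies it by a factor other
-- than 1, and such a b is found by counting roots of a polynomial.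

private
  variable
    c ℓ c₁ ℓ₁ c₂ ℓ₂ : Level


-- Field arithmetic, Frobenius and counting roots

module FieldProperties (K : Field c ℓ) where

  open Field K public hiding (zero)
  open import Algebra.Properties.Ring ring public
    using (-‿involutive; -‿distribˡ-*; -‿distribʳ-*; -0#≈0#; x∙y⁻¹≈ε⇒x≈y)
  open import Algebra.Properties.AbelianGroup +-abelianGroup using (⁻¹-∙-comm)
  open import Algebra.Properties.CommutativeSemiring.Exp commutativeSemiring public
  open import Algebra.Properties.Semiring.Mult semiring public
    renaming (_×_ to _·_)
  open import Algebra.Properties.Semiring.Sum semiring public
    using (sum; sum-cong-≋; sum-init-last; sum-replicate-zero)
  open import Relation.Binary.Reasoning.Setoid setoid public

  fromℤ-⊖ : ∀ m n → fromℤ K (m ℤ.⊖ n) ≈ m · 1# - n · 1#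
  fromℤ-⊖ zero    zero    = sym (-‿inverseʳ 0#)
  fromℤ-⊖ zero    (suc n) = sym (+-identityˡ _)
  fromℤ-⊖ (suc m) zero    = sym (trans (+-congˡ -0#≈0#) (+-identityʳ _))
  fromℤ-⊖ (suc m) (suc n) = begin
    fromℤ K (suc m ℤ.⊖ suc n)             ≡⟨ ≡.cong (fromℤ K) (ℤₚ.[1+m]⊖[1+n]≡m⊖n m n) ⟩
    fromℤ K (m ℤ.⊖ n)                     ≈⟨ fromℤ-⊖ m n ⟩
    a - b                                 ≈⟨ +-congʳ (+-identityˡ a) ⟨
    (0# + a) - b                          ≈⟨ +-congʳ (+-congʳ (-‿inverseʳ 1#)) ⟨
    (1# - 1# + a) - b                     ≈⟨ +-congʳ (+-assoc _ _ _) ⟩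
    1# + (- 1# + a) - b                   ≈⟨ +-congʳ (+-congˡ (+-comm _ _)) ⟩
    1# + (a - 1#) - b                     ≈⟨ +-congʳ (+-assoc _ _ _) ⟨
    1# + a - 1# - b                       ≈⟨ +-assoc _ _ _ ⟩
    1# + a + (- 1# - b)                   ≈⟨ +-congˡ (⁻¹-∙-comm 1# b) ⟩
    1# + a - (1# + b)                     ∎
    where
    a = m · 1#
    b = n · 1#

  fromℤ-+ : ∀ i j → fromℤ K (i ℤ.+ j) ≈ fromℤ K i + fromℤ K j
  fromℤ-+ (+ m)    (+ n)    = ×-homo-+ 1# m n
  fromℤ-+ (+ m)    -[1+ n ] = fromℤ-⊖ m (suc n)
  fromℤ-+ -[1+ m ] (+ n)    = trans (fromℤ-⊖ n (suc m)) (+-comm _ _)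
  fromℤ-+ -[1+ m ] -[1+ n ] = begin
    - (suc (suc (m ℕ.+ n)) · 1#)          ≡⟨ ≡.cong (λ k → - (suc k · 1#)) (ℕₚ.+-suc m n) ⟨
    - ((suc m ℕ.+ suc n) · 1#)            ≈⟨ -‿cong (×-homo-+ 1# (suc m) (suc n)) ⟩
    - (suc m · 1# + suc n · 1#)           ≈⟨ ⁻¹-∙-comm _ _ ⟨
    - (suc m · 1#) - suc n · 1#           ∎

  fromℤ-neg : ∀ i → fromℤ K (ℤ.- i) ≈ - fromℤ K i
  fromℤ-neg (+ zero)  = sym -0#≈0#
  fromℤ-neg (+ suc n) = refl
  fromℤ-neg -[1+ n ]  = sym (-‿involutive _)

  fromℤ-* : ∀ i j → fromℤ K (i ℤ.* j) ≈ fromℤ K i * fromℤ K j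
  fromℤ-* (+ m) (+ n) = trans (reflexive (≡.cong (fromℤ K) (≡.sym (ℤₚ.pos-* m n)))) (×1-homo-* m n)
  fromℤ-* (+ m) -[1+ n ] = begin
    fromℤ K (+ m ℤ.* ℤ.- (+ suc n))   ≡⟨ ≡.cong (fromℤ K) (ℤₚ.neg-distribʳ-* (+ m) (+ suc n)) ⟨
    fromℤ K (ℤ.- (+ m ℤ.* + suc n))   ≈⟨ fromℤ-neg (+ m ℤ.* + suc n) ⟩
    - fromℤ K (+ m ℤ.* + suc n)       ≈⟨ -‿cong (fromℤ-* (+ m) (+ suc n)) ⟩
    - (m · 1# * suc n · 1#)           ≈⟨ -‿distribʳ-* _ _ ⟩
    m · 1# * - (suc n · 1#)           ∎
  fromℤ-* -[1+ m ] j = begin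
    fromℤ K (ℤ.- (+ suc m) ℤ.* j)     ≡⟨ ≡.cong (fromℤ K) (ℤₚ.neg-distribˡ-* (+ suc m) j) ⟨
    fromℤ K (ℤ.- (+ suc m ℤ.* j))     ≈⟨ fromℤ-neg (+ suc m ℤ.* j) ⟩
    - fromℤ K (+ suc m ℤ.* j)         ≈⟨ -‿cong (pos j) ⟩
    - (suc m · 1# * fromℤ K j)        ≈⟨ -‿distribˡ-* _ _ ⟩
    - (suc m · 1#) * fromℤ K j        ∎
    where
    pos : ∀ j → fromℤ K (+ suc m ℤ.* j) ≈ suc m · 1# * fromℤ K j
    pos (+ n) = trans (reflexive (≡.cong (fromℤ K) (≡.sym (ℤₚ.pos-* (suc m) n)))) (×1-homo-* (suc m) n)
    pos -[1+ n ] = trans (-‿cong (×1-homo-* (suc m) (suc n))) (-‿distribʳ-* _ _)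

  private
    -- fromℤ K (+ 1) is 1# + 0#; here the solver's constant 1 is 1# on the nose.
    ⟦_⟧ : ℤ → Carrier
    ⟦ + 1 ⟧ = 1#
    ⟦ i   ⟧ = fromℤ K i

    ⟦⟧≈fromℤ : ∀ i → ⟦ i ⟧ ≈ fromℤ K i
    ⟦⟧≈fromℤ (+ 0)           = refl
    ⟦⟧≈fromℤ (+ 1)           = sym (+-identityʳ 1#)
    ⟦⟧≈fromℤ (+ suc (suc n)) = refl
    ⟦⟧≈fromℤ -[1+ n ]        = refl

    ℤ-morphism : ℤ.+-*-rawRing -Raw-AlmostCommutative⟶ fromCommutativeRing commutativeRing
    ℤ-morphism = record
      { ⟦_⟧    = ⟦_⟧
      ; +-homo = λ i j → trans (⟦⟧≈fromℤ (i ℤ.+ j))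
                   (trans (fromℤ-+ i j) (sym (+-cong (⟦⟧≈fromℤ i) (⟦⟧≈fromℤ j))))
      ; *-homo = λ i j → trans (⟦⟧≈fromℤ (i ℤ.* j))
                   (trans (fromℤ-* i j) (sym (*-cong (⟦⟧≈fromℤ i) (⟦⟧≈fromℤ j))))
      ; -‿homo = λ i → trans (⟦⟧≈fromℤ (ℤ.- i))
                   (trans (fromℤ-neg i) (-‿cong (sym (⟦⟧≈fromℤ i))))
      ; 0-homo = refl
      ; 1-homo = refl
      }

    coefficients≟ : WeaklyDecidable (λ i j → ⟦ i ⟧ ≈ ⟦ j ⟧)
    coefficients≟ i j with i ℤₚ.≟ j
    ... | yes ≡.refl = just (refl {⟦ i ⟧})
    ... | no  _      = nothing

  open Algebra.Solver.Ring ℤ.+-*-rawRing (fromCommutativeRing commutativeRing)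
    ℤ-morphism coefficients≟ public
    using (solve; _:=_; _:+_; _:*_; _:-_; :-_; con)

  x-y≈0⇒x≈y : ∀ {x y} → x - y ≈ 0# → x ≈ y
  x-y≈0⇒x≈y = x∙y⁻¹≈ε⇒x≈y _ _

  x≈y⇒x-y≈0 : ∀ {x y} → x ≈ y → x - y ≈ 0#
  x≈y⇒x-y≈0 x≈y = trans (+-congʳ x≈y) (-‿inverseʳ _)

  *-cancel-≉0 : ∀ {x y} → ¬ (x ≈ 0#) → x * y ≈ 0# → y ≈ 0#
  *-cancel-≉0 {x} {y} x≉0 xy≈0 = begin
    y                ≈⟨ *-identityˡ y ⟨
    1# * y           ≈⟨ *-congʳ xx⁻¹≈1 ⟨
    x * x⁻¹ * y      ≈⟨ solve 3 (λ x x⁻¹ y → x :* x⁻¹ :* y := x⁻¹ :* (x :* y)) refl x x⁻¹ y ⟩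
    x⁻¹ * (x * y)    ≈⟨ *-congˡ xy≈0 ⟩
    x⁻¹ * 0#         ≈⟨ zeroʳ _ ⟩
    0#               ∎
    where
    x⁻¹ = proj₁ (inverse x x≉0)
    xx⁻¹≈1 = proj₂ (inverse x x≉0)

  *-cancelˡ-≉0 : ∀ {x y z} → ¬ (x ≈ 0#) → x * y ≈ x * z → y ≈ z
  *-cancelˡ-≉0 {x} {y} {z} x≉0 xy≈xz = x-y≈0⇒x≈y (*-cancel-≉0 x≉0
    (trans (solve 3 (λ x y z → x :* (y :- z) := x :* y :- x :* z) refl x y z) (x≈y⇒x-y≈0 xy≈xz)))

  *-≉0 : ∀ {x y} → ¬ (x ≈ 0#) → ¬ (y ≈ 0#) → ¬ (x * y ≈ 0#)
  *-≉0 x≉0 y≉0 xy≈0 = y≉0 (*-cancel-≉0 x≉0 xy≈0)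

  ^-≉0 : ∀ {x} → ¬ (x ≈ 0#) → ∀ n → ¬ (x ^ n ≈ 0#)
  ^-≉0 x≉0 zero    = 1≉0
  ^-≉0 x≉0 (suc n) = *-≉0 x≉0 (^-≉0 x≉0 n)

  1^n≈1 : ∀ n → 1# ^ n ≈ 1#
  1^n≈1 zero    = refl
  1^n≈1 (suc n) = trans (*-identityˡ _) (1^n≈1 n)

  0^[1+n]≈0 : ∀ n → 0# ^ suc n ≈ 0#
  0^[1+n]≈0 n = zeroˡ _

  module Frobenius (p : ℕ) (p-prime : Prime p) (p·1≈0 : p · 1# ≈ 0#) where

    private
      p∣k!⇒p≤k : ∀ k → p ∣ k ℕ.! → p ℕ.≤ k
      p∣k!⇒p≤k zero    p∣1 = contradiction (∣1⇒≡1 p∣1) (ℕₚ.<⇒≢ (ℕ.nonTrivial⇒n>1 p {{prime⇒nonTrivial p-prime}}) ∘ ≡.sym)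
      p∣k!⇒p≤k (suc k) p∣ with euclidsLemma (suc k) (k ℕ.!) p-prime p∣
      ... | inj₁ p∣1+k = ∣⇒≤ p∣1+k
      ... | inj₂ p∣k!  = ℕₚ.m≤n⇒m≤1+n (p∣k!⇒p≤k k p∣k!)

      n∣n! : ∀ n .{{_ : ℕ.NonZero n}} → n ∣ n ℕ.!
      n∣n! (suc n) = m∣m*n (n ℕ.!)

      -- The product C(p,k) · k! · (p-k)! is p!, and a prime dividing a factorial is at most its
      -- argument, so neither factorial can absorb `p`.
      p∣pCk : ∀ k → 1 ℕ.≤ k → k ℕ.< p → p ∣ p C k
      p∣pCk k 1≤k k<p = [ (λ p∣C → p∣C) , ⊥-elim ∘ absurd ]′
        (euclidsLemma (p C k) (k ℕ.! ℕ.* (p ℕ.∸ k) ℕ.!) p-prime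
          (≡.subst (p ∣_) (≡.sym C*k![p-k]!≡p!) (n∣n! p {{prime⇒nonZero p-prime}})))
        where
        instance _ = ℕₚ.m*n≢0 (k ℕ.!) ((p ℕ.∸ k) ℕ.!) {{k ℕₚ.!≢0}} {{(p ℕ.∸ k) ℕₚ.!≢0}}
        C*k![p-k]!≡p! : (p C k) ℕ.* (k ℕ.! ℕ.* (p ℕ.∸ k) ℕ.!) ≡ p ℕ.!
        C*k![p-k]!≡p! = ≡.trans
          (≡.cong (ℕ._* (k ℕ.! ℕ.* (p ℕ.∸ k) ℕ.!)) (nCk≡n!/k![n-k]! (ℕₚ.<⇒≤ k<p)))
          (ℕᵈ.m/n*n≡m (k![n∸k]!∣n! (ℕₚ.<⇒≤ k<p)))
        absurd : p ∣ k ℕ.! ℕ.* (p ℕ.∸ k) ℕ.! → ⊥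
        absurd p∣ with euclidsLemma (k ℕ.!) ((p ℕ.∸ k) ℕ.!) p-prime p∣
        ... | inj₁ p∣k!   = ℕₚ.<⇒≱ k<p (p∣k!⇒p≤k k p∣k!)
        ... | inj₂ p∣p-k! = ℕₚ.<⇒≱ (ℕₚ.∸-monoʳ-< {p} {k} {0} 1≤k (ℕₚ.<⇒≤ k<p)) (p∣k!⇒p≤k (p ℕ.∸ k) p∣p-k!)

    char∣⇒·≈0 : ∀ {n} → p ∣ n → ∀ x → n · x ≈ 0#
    char∣⇒·≈0 {n} (divides m n≡m*p) x = begin
      n · x                  ≡⟨ ≡.cong (_· x) n≡m*p ⟩
      (m ℕ.* p) · x          ≈⟨ ×-congʳ (m ℕ.* p) (*-identityˡ x) ⟨
      (m ℕ.* p) · (1# * x)   ≈⟨ ×-assoc-* (m ℕ.* p) 1# x ⟨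
      (m ℕ.* p) · 1# * x     ≈⟨ *-congʳ (×1-homo-* m p) ⟩
      m · 1# * p · 1# * x    ≈⟨ *-congʳ (*-congˡ p·1≈0) ⟩
      m · 1# * 0# * x        ≈⟨ *-congʳ (zeroʳ _) ⟩
      0# * x                 ≈⟨ zeroˡ x ⟩
      0#                     ∎

    ^p-distrib-+ : ∀ x y → (x + y) ^ p ≈ x ^ p + y ^ p
    -- The exponent is generalised so that it can be matched as `suc r`, which splits off the first
    -- and last binomial terms.
    ^p-distrib-+ x y = go p ≡.refl
      where
      open import Algebra.Properties.CommutativeSemiring.Binomial commutativeSemiring
        using (theorem; binomialTerm)
      go : ∀ p′ → p′ ≡ p → (x + y) ^ p′ ≈ x ^ p′ + y ^ p′
      go zero    0≡p = contradiction (≡.sym 0≡p) (ℕ.≢-nonZero⁻¹ p {{prime⇒nonZero p-prime}})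
      go (suc r) ≡.refl = begin
        (x + y) ^ suc r                            ≈⟨ theorem (suc r) x y ⟩
        sum term                                   ≈⟨ +-congˡ (sum-init-last (term ∘ suc)) ⟩
        term zero + (sum (λ i → term (suc (inject₁ i))) + term (suc (fromℕ r)))
          ≈⟨ +-cong first (+-cong (trans (sum-cong-≋ middle) (sum-replicate-zero r)) last) ⟩
        y ^ suc r + (0# + x ^ suc r)               ≈⟨ solve 2 (λ a b → a :+ (con (+ 0) :+ b) := b :+ a) refl _ _ ⟩
        x ^ suc r + y ^ suc r                      ∎
        where
        term = binomialTerm x y (suc r)
        first : term zero ≈ y ^ suc r
        first = trans (×-homo-1 _) (*-identityˡ _)
        last : term (suc (fromℕ r)) ≈ x ^ suc r
        last rewrite Finₚ.toℕ-fromℕ r | nCn≡1 (suc r) | ℕₚ.n∸n≡0 r =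
          trans (×-homo-1 _) (*-identityʳ _)
        middle : ∀ i → term (suc (inject₁ i)) ≈ 0#
        middle i = char∣⇒·≈0 (p∣pCk (suc (toℕ (inject₁ i))) (s≤s z≤n)
          (s≤s (≡.subst (ℕ._< r) (≡.sym (Finₚ.toℕ-inject₁ i)) (Finₚ.toℕ<n i)))) _

    ^p^k-distrib-+ : ∀ k x y → (x + y) ^ (p ℕ.^ k) ≈ x ^ (p ℕ.^ k) + y ^ (p ℕ.^ k)
    ^p^k-distrib-+ zero    x y = trans (*-identityʳ _) (sym (+-cong (*-identityʳ _) (*-identityʳ _)))
    ^p^k-distrib-+ (suc k) x y = begin
      (x + y) ^ (p ℕ.* p ℕ.^ k)                          ≈⟨ ^-assocʳ _ p _ ⟨
      ((x + y) ^ p) ^ (p ℕ.^ k)                          ≈⟨ ^-congˡ (p ℕ.^ k) (^p-distrib-+ x y) ⟩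
      (x ^ p + y ^ p) ^ (p ℕ.^ k)                        ≈⟨ ^p^k-distrib-+ k _ _ ⟩
      (x ^ p) ^ (p ℕ.^ k) + (y ^ p) ^ (p ℕ.^ k)          ≈⟨ +-cong (^-assocʳ _ p _) (^-assocʳ _ p _) ⟩
      x ^ (p ℕ.* p ℕ.^ k) + y ^ (p ℕ.* p ℕ.^ k)          ∎

  -- The vector lists all coefficients but the leading one, constant term first.
  evalMonic : ∀ {n} → Vec Carrier n → Carrier → Carrier
  evalMonic []       x = 1#
  evalMonic (a ∷ as) x = a + x * evalMonic as x

  -- Synthetic division by X - r: the coefficients of the quotient are the values at r of the tails
  -- in Horner's scheme.
  quotient : ∀ {n} → Carrier → Vec Carrier (suc n) → Vec Carrier n
  quotient r (a ∷ [])     = []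
  quotient r (a ∷ b ∷ bs) = evalMonic (b ∷ bs) r ∷ quotient r (b ∷ bs)

  quotient-correct : ∀ {n} r (as : Vec Carrier (suc n)) x →
    evalMonic as x - evalMonic as r ≈ (x - r) * evalMonic (quotient r as) x
  quotient-correct r (a ∷ []) x =
    solve 4 (λ a x r o → a :+ x :* o :- (a :+ r :* o) := (x :- r) :* o) refl a x r 1#
  quotient-correct r (a ∷ b ∷ bs) x = begin
    a + x * Px - (a + r * Pr)          ≈⟨ solve 5 (λ a x r u v → a :+ x :* u :- (a :+ r :* v) := x :* (u :- v) :+ (x :- r) :* v) refl a x r Px Pr ⟩
    x * (Px - Pr) + (x - r) * Pr       ≈⟨ +-congʳ (*-congˡ (quotient-correct r (b ∷ bs) x)) ⟩
    x * ((x - r) * Q) + (x - r) * Pr   ≈⟨ solve 4 (λ x r q v → x :* ((x :- r) :* q) :+ (x :- r) :* v := (x :- r) :* (v :+ x :* q)) refl x r Q Pr ⟩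
    (x - r) * (Pr + x * Q)             ∎
    where
    Px = evalMonic (b ∷ bs) x
    Pr = evalMonic (b ∷ bs) r
    Q  = evalMonic (quotient r (b ∷ bs)) x

  -- Division by X minus one root lowers the degree, and the other roots survive in the quotient
  -- because there are no zero divisors.
  monic-few-roots : ∀ n (as : Vec Carrier n) (r : Fin (suc n) → Carrier) →
    (∀ {i j} → r i ≈ r j → i ≡ j) → ¬ (∀ i → evalMonic as (r i) ≈ 0#)
  monic-few-roots zero    []         r r-injective roots = 1≉0 (roots zero)
  monic-few-roots (suc n) as r r-injective roots =
    monic-few-roots n (quotient (r zero) as) (r ∘ suc) (Finₚ.suc-injective ∘ r-injective)
      λ i → *-cancel-≉0 (λ d≈0 → suc≢0 (r-injective (x-y≈0⇒x≈y d≈0))) (begin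
        (r (suc i) - r zero) * evalMonic (quotient (r zero) as) (r (suc i))  ≈⟨ quotient-correct (r zero) as (r (suc i)) ⟨
        evalMonic as (r (suc i)) - evalMonic as (r zero)                     ≈⟨ +-cong (roots (suc i)) (-‿cong (roots zero)) ⟩
        0# - 0#                                                              ≈⟨ -‿inverseʳ 0# ⟩
        0#                                                                   ∎)
    where
    suc≢0 : ∀ {i : Fin (suc n)} → suc i ≢ zero
    suc≢0 ()

-- A missed value could be punched out, which would leave an injection into a smaller set.
injective⇒surjective : ∀ {n} {f : Fin n → Fin n} → Injective _≡_ _≡_ f → ∀ j → ∃[ i ] f i ≡ j
injective⇒surjective {suc n} {f} f-injective j with Finₚ.any? (λ i → f i Finₚ.≟ j)
... | yes hit  = hit
... | no  miss = contradiction
  (Finₚ.injective⇒≤ {f = λ i → punchOut (j≢f i)} (f-injective ∘ Finₚ.punchOut-injective (j≢f _) (j≢f _)))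
  ℕₚ.1+n≰n
  where
  j≢f : ∀ i → j ≢ f i
  j≢f i j≡fi = miss (i , ≡.sym j≡fi)

-- Finite fields: sums and products over all elements

module FiniteField (K : Field c ℓ) (N : ℕ) (K-card : HasCardinality K N) where

  open FieldProperties K
  open Inverse K-card public using ()
    renaming ( to to index; from to element; to-cong to index-cong
             ; strictlyInverseˡ to index-element; strictlyInverseʳ to element-index )

  index-injective : ∀ {x y} → index x ≡ index y → x ≈ y
  index-injective {x} {y} eq =
    trans (sym (element-index x)) (trans (reflexive (≡.cong element eq)) (element-index y))

  element-injective : ∀ {i j} → element i ≈ element j → i ≡ j
  element-injective {i} {j} eq =
    ≡.trans (≡.sym (index-element i)) (≡.trans (index-cong eq) (index-element j))

  infix 4 _≟_
  _≟_ : Decidable _≈_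
  x ≟ y = map′ index-injective index-cong (index x Finₚ.≟ index y)

  *≈0⇒≈0 : ∀ {x y} → x * y ≈ 0# → x ≈ 0# ⊎ y ≈ 0#
  *≈0⇒≈0 {x} {y} xy≈0 with x ≟ 0#
  ... | yes x≈0 = inj₁ x≈0
  ... | no  x≉0 = inj₂ (*-cancel-≉0 x≉0 xy≈0)

  ^≈0⇒≈0 : ∀ {x} n → x ^ n ≈ 0# → x ≈ 0#
  ^≈0⇒≈0 {x} n xⁿ≈0 = decidable-stable (x ≟ 0#) λ x≉0 → ^-≉0 x≉0 n xⁿ≈0

  injective⇒bijective : ∀ {f} → (∀ {x y} → x ≈ y → f x ≈ f y) →
    (∀ {x y} → f x ≈ f y → x ≈ y) → Bijective _≈_ _≈_ f
  injective⇒bijective {f} f-cong f-injective = f-injective , λ y →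
    let i , fi≡y = injective⇒surjective {f = index ∘ f ∘ element}
                     (element-injective ∘ f-injective ∘ index-injective) (index y)
    in element i , λ z≈x → trans (f-cong z≈x) (index-injective fi≡y)

  *-bijective : ∀ {a} → ¬ (a ≈ 0#) → Bijective _≈_ _≈_ (a *_)
  *-bijective a≉0 = injective⇒bijective *-congˡ (*-cancelˡ-≉0 a≉0)

  module BigOperator {c′ ℓ′} (M : CommutativeMonoid c′ ℓ′) where

    private module M = CommutativeMonoid M
    module S = Algebra.Properties.CommutativeMonoid.Sum M

    ⨁ : (Carrier → M.Carrier) → M.Carrier
    ⨁ g = S.sum (g ∘ element)

    ⨁-cong : ∀ {g h} → (∀ x → g x M.≈ h x) → ⨁ g M.≈ ⨁ h
    ⨁-cong g≈h = S.sum-cong-≋ (g≈h ∘ element)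

    ⨁-reindex : ∀ {g σ} → (∀ {x y} → x ≈ y → g x M.≈ g y) → Bijective _≈_ _≈_ σ →
      ⨁ (g ∘ σ) M.≈ ⨁ g
    ⨁-reindex {g} {σ} g-cong (σ-injective , σ-surjective) = M.sym (M.trans
      (S.sum-permute (g ∘ element) π)
      (S.sum-cong-≋ λ i → g-cong (element-index (σ (element i)))))
      where
      σ⁻¹ : Carrier → Carrier
      σ⁻¹ y = proj₁ (σ-surjective y)
      σσ⁻¹ : ∀ y → σ (σ⁻¹ y) ≈ y
      σσ⁻¹ y = proj₂ (σ-surjective y) refl
      σσ⁻¹-index : ∀ j → σ (element (index (σ⁻¹ (element j)))) ≈ element j
      σσ⁻¹-index j = proj₂ (σ-surjective (element j)) (element-index _)
      π : Permutation N N
      π = permutation (index ∘ σ ∘ element) (index ∘ σ⁻¹ ∘ element)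
        (λ j → ≡.trans (index-cong (σσ⁻¹-index j)) (index-element j))
        (λ i → ≡.trans (index-cong (σ-injective (trans (σσ⁻¹ _) (element-index _)))) (index-element i))

    ⨁-single : ∀ {g} x → (∀ {y z} → y ≈ z → g y M.≈ g z) →
      (∀ y → ¬ (y ≈ x) → g y M.≈ M.ε) → ⨁ g M.≈ g x
    ⨁-single {g} x g-cong g-else =
      M.trans (sum-single (g ∘ element) (index x) λ i i≢ →
                g-else (element i) λ eq → i≢ (≡.trans (≡.sym (index-element i)) (index-cong eq)))
              (g-cong (element-index x))
      where
      sum-single : ∀ {n} (t : Fin n → M.Carrier) i → (∀ j → j ≢ i → t j M.≈ M.ε) → S.sum t M.≈ t i
      sum-single {suc n} t i t-else = M.trans (S.sum-remove {i = i} t) (M.trans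
        (M.∙-congˡ (M.trans (S.sum-cong-≋ λ j → t-else (Fin.punchIn i j) (Finₚ.punchInᵢ≢i i j))
                            (S.sum-replicate-zero n)))
        (M.identityʳ _))

  open BigOperator +-commutativeMonoid public using ()
    renaming (⨁ to Σ; ⨁-cong to Σ-cong; ⨁-reindex to Σ-reindex; ⨁-single to Σ-single)
  open BigOperator *-commutativeMonoid using ()
    renaming (⨁ to Π; ⨁-cong to Π-cong; ⨁-reindex to Π-reindex; ⨁-single to Π-single)

  import Algebra.Properties.Semiring.Sum semiring as Sum
  import Algebra.Properties.CommutativeMonoid.Sum *-commutativeMonoid as Product

  Σ-+ : ∀ g h → Σ (λ x → g x + h x) ≈ Σ g + Σ h
  Σ-+ g h = Sum.∑-distrib-+ (g ∘ element) (h ∘ element)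

  Σ-* : ∀ a g → Σ (λ x → a * g x) ≈ a * Σ g
  Σ-* a g = sym (Sum.*-distribˡ-sum a (g ∘ element))

  Π-≉0 : ∀ {g} → (∀ x → ¬ (g x ≈ 0#)) → ¬ (Π g ≈ 0#)
  Π-≉0 {g} g≉0 = product-≉0 (g≉0 ∘ element)
    where
    product-≉0 : ∀ {n} {t : Fin n → Carrier} → (∀ i → ¬ (t i ≈ 0#)) → ¬ (Product.sum t ≈ 0#)
    product-≉0 {zero}  t≉0 = 1≉0
    product-≉0 {suc n} t≉0 = *-≉0 (t≉0 zero) (product-≉0 (t≉0 ∘ suc))

  -- Translation by 1 permutes the field, so the sum of all elements equals itself plus N times 1.
  cardinality·1≈0 : N · 1# ≈ 0#
  cardinality·1≈0 = begin
    N · 1#                                ≈⟨ solve 2 (λ n s → n := (s :+ n) :- s) refl _ (Σ id) ⟩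
    Σ id + N · 1# - Σ id                  ≈⟨ +-congʳ (+-congˡ (Sum.sum-replicate N)) ⟨
    Σ id + Σ (λ _ → 1#) - Σ id            ≈⟨ +-congʳ (Σ-+ id (λ _ → 1#)) ⟨
    Σ (λ x → x + 1#) - Σ id               ≈⟨ +-congʳ (Σ-reindex id (injective⇒bijective +-congʳ
                                               λ {x} {y} eq → trans (sym (cancel x)) (trans (+-congʳ eq) (cancel y)))) ⟩
    Σ id - Σ id                           ≈⟨ -‿inverseʳ _ ⟩
    0#                                    ∎
    where
    cancel : ∀ x → x + 1# - 1# ≈ x
    cancel x = solve 2 (λ x o → x :+ o :- o := x) refl x 1#

  private
    ifZero : Carrier → Carrier → Carrier → Carrier
    ifZero u v x with x ≟ 0#
    ... | yes _ = u
    ... | no  _ = v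

    ifZero-≈0 : ∀ {u v x} → x ≈ 0# → ifZero u v x ≈ u
    ifZero-≈0 {x = x} x≈0 with x ≟ 0#
    ... | yes _   = refl
    ... | no  x≉0 = contradiction x≈0 x≉0

    ifZero-≉0 : ∀ {u v x} → ¬ (x ≈ 0#) → ifZero u v x ≈ v
    ifZero-≉0 {x = x} x≉0 with x ≟ 0#
    ... | yes x≈0 = contradiction x≈0 x≉0
    ... | no  _   = refl

    ifZero-cong : ∀ {u v v′ x x′} → v ≈ v′ → x ≈ x′ → ifZero u v x ≈ ifZero u v′ x′
    ifZero-cong {x = x} {x′} v≈v′ x≈x′ with x ≟ 0# | x′ ≟ 0#
    ... | yes _   | yes _    = refl
    ... | yes x≈0 | no  x′≉0 = contradiction (trans (sym x≈x′) x≈0) x′≉0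
    ... | no  x≉0 | yes x′≈0 = contradiction (trans x≈x′ x′≈0) x≉0
    ... | no  _   | no  _    = v≈v′

  -- Multiplying by a permutes the field, so it multiplies the product P of all
  -- nonzero elements by 1; the factor at 0 accounts for one of the N factors a.
  x^cardinality≈x : ∀ a → a ^ N ≈ a
  x^cardinality≈x a with a ≟ 0#
  ... | yes a≈0 = trans (^-congˡ N a≈0) (trans (0^N≈0 N (index 0#)) (sym a≈0))
    where
    0^N≈0 : ∀ n → Fin n → 0# ^ n ≈ 0#
    0^N≈0 (suc n) _ = 0^[1+n]≈0 n
  ... | no  a≉0 = *-cancelˡ-≉0 P≉0 (begin
      P * a ^ N                      ≈⟨ *-comm P _ ⟩
      a ^ N * P                      ≈⟨ *-congʳ (Product.sum-replicate N) ⟨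
      Π (λ _ → a) * P                ≈⟨ Product.∑-distrib-+ (λ _ → a) (h ∘ element) ⟨
      Π (λ x → a * h x)              ≈⟨ Π-cong pointwise ⟨
      Π (λ x → h (a * x) * e x)      ≈⟨ Product.∑-distrib-+ (h ∘ (a *_) ∘ element) (e ∘ element) ⟩
      Π (h ∘ (a *_)) * Π e           ≈⟨ *-cong (Π-reindex h-cong (*-bijective a≉0))
                                          (Π-single 0# (ifZero-cong refl) (λ _ → ifZero-≉0)) ⟩
      P * e 0#                       ≈⟨ *-congˡ (ifZero-≈0 refl) ⟩
      P * a                          ∎)
    where
    h e : Carrier → Carrier
    h x = ifZero 1# x x
    e = ifZero a 1#
    h-cong : ∀ {x y} → x ≈ y → h x ≈ h y
    h-cong x≈y = ifZero-cong x≈y x≈y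
    P = Π h
    P≉0 : ¬ (P ≈ 0#)
    P≉0 = Π-≉0 λ x → h≉0 x (x ≟ 0#)
      where
      h≉0 : ∀ x → Dec (x ≈ 0#) → ¬ (h x ≈ 0#)
      h≉0 x (yes x≈0) hx≈0 = 1≉0 (trans (sym (ifZero-≈0 x≈0)) hx≈0)
      h≉0 x (no  x≉0) hx≈0 = x≉0 (trans (sym (ifZero-≉0 x≉0)) hx≈0)
    pointwise : ∀ x → h (a * x) * e x ≈ a * h x
    pointwise x = go (x ≟ 0#)
      where
      go : Dec (x ≈ 0#) → h (a * x) * e x ≈ a * h x
      go (yes x≈0) = trans (*-cong (ifZero-≈0 (trans (*-congˡ x≈0) (zeroʳ a))) (ifZero-≈0 x≈0))
        (trans (*-comm _ _) (*-congˡ (sym (ifZero-≈0 x≈0))))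
      go (no  x≉0) = trans (*-cong (ifZero-≉0 (*-≉0 a≉0 x≉0)) (ifZero-≉0 x≉0))
        (trans (*-identityʳ _) (*-congˡ (sym (ifZero-≉0 x≉0))))

  recip : Carrier → Carrier
  recip x with x ≟ 0#
  -- A default value: reciprocals are only evaluated through `*-recip`, at nonzero arguments.
  ... | yes _   = 0#
  ... | no  x≉0 = proj₁ (inverse x x≉0)

  *-recip : ∀ {x} → ¬ (x ≈ 0#) → x * recip x ≈ 1#
  *-recip {x} x≉0 with x ≟ 0#
  ... | yes x≈0 = contradiction x≈0 x≉0
  ... | no  x≉0 = proj₂ (inverse x x≉0)

  -- The k-th power of p · 1 is N · 1 = 0, and a field has no nilpotents.
  p·1≈0 : ∀ p k → N ≡ p ℕ.^ k → p · 1# ≈ 0#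
  p·1≈0 p k N≡p^k = ^≈0⇒≈0 k (trans (sym (·-^ k))
    (trans (×-congˡ (≡.sym N≡p^k)) cardinality·1≈0))
    where
    ·-^ : ∀ k → (p ℕ.^ k) · 1# ≈ (p · 1#) ^ k
    ·-^ zero    = ×-homo-1 1#
    ·-^ (suc k) = trans (×1-homo-* p (p ℕ.^ k)) (*-congˡ (·-^ k))

  -- Otherwise all N elements would be roots of X^(d+2) - X. The extra factor X makes 0 a root too,
  -- so that no element has to be set aside in the count.
  ∃-x^d≉1 : ∀ d → suc (suc d) ℕ.< N → ∃[ x ] ¬ (x ≈ 0#) × ¬ (x ^ suc d ≈ 1#)
  ∃-x^d≉1 d 2+d<N with Finₚ.any? (λ i → ¬? (element i ^ suc (suc d) ≟ element i))
  ... | yes (i , ne) = element i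
      , (λ x≈0 → ne (trans (^-congˡ (suc (suc d)) x≈0) (trans (0^[1+n]≈0 (suc d)) (sym x≈0))))
      , (λ eq → ne (trans (*-congˡ eq) (*-identityʳ _)))
  ... | no  none = ⊥-elim (monic-few-roots (suc (suc d)) X^[2+d]-X (element ∘ λ i → inject≤ i 2+d<N)
      (Finₚ.inject≤-injective 2+d<N 2+d<N _ _ ∘ element-injective)
      (λ i → root _ (decidable-stable (_ ≟ _) λ ne → none (_ , ne))))
    where
    X^[2+d]-X : Vec Carrier (suc (suc d))
    X^[2+d]-X = 0# ∷ - 1# ∷ Vec.replicate d 0#
    evalMonic-replicate : ∀ n x → evalMonic (Vec.replicate n 0#) x ≈ x ^ n
    evalMonic-replicate zero    x = refl
    evalMonic-replicate (suc n) x = trans (+-identityˡ _) (*-congˡ (evalMonic-replicate n x))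
    root : ∀ x → x ^ suc (suc d) ≈ x → evalMonic X^[2+d]-X x ≈ 0#
    root x eq = begin
      0# + x * (- 1# + x * evalMonic (Vec.replicate d 0#) x)   ≈⟨ +-congˡ (*-congˡ (+-congˡ (*-congˡ (evalMonic-replicate d x)))) ⟩
      0# + x * (- 1# + x * x ^ d)    ≈⟨ solve 2 (λ x u → con (+ 0) :+ x :* (:- con (+ 1) :+ x :* u) := x :* (x :* u) :- x) refl x (x ^ d) ⟩
      x ^ suc (suc d) - x            ≈⟨ x≈y⇒x-y≈0 eq ⟩
      0#                             ∎

  -- Substituting b x for x leaves the sum unchanged and also multiplies it by κ.
  Σ-eigenfunction≈0 : ∀ {g b κ} → (∀ {x y} → x ≈ y → g x ≈ g y) → ¬ (b ≈ 0#) → ¬ (κ ≈ 1#) →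
    (∀ x → g (b * x) ≈ κ * g x) → Σ g ≈ 0#
  Σ-eigenfunction≈0 {g} {b} {κ} g-cong b≉0 κ≉1 eigen = *-cancel-≉0 (κ≉1 ∘ x-y≈0⇒x≈y) (begin
    (κ - 1#) * Σ g           ≈⟨ distribʳ _ _ _ ⟩
    κ * Σ g + - 1# * Σ g     ≈⟨ +-cong (sym (Σ-* κ g)) (-1*x≈-x _) ⟩
    Σ (λ x → κ * g x) - Σ g  ≈⟨ +-congʳ (Σ-cong eigen) ⟨
    Σ (g ∘ (b *_)) - Σ g     ≈⟨ x≈y⇒x-y≈0 (Σ-reindex g-cong (*-bijective b≉0)) ⟩
    0#                       ∎)
    where open import Algebra.Properties.Ring ring using (-1*x≈-x)

  Σ-^≈0 : ∀ d → suc (suc d) ℕ.< N → Σ (_^ suc d) ≈ 0#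
  Σ-^≈0 d d<N = let b , b≉0 , b^d≉1 = ∃-x^d≉1 d d<N in
    Σ-eigenfunction≈0 (^-congˡ (suc d)) b≉0 b^d≉1 (λ x → ^-distrib-* b x (suc d))

  -- The function 1 - δ is supported at 0 and sums to 1, while the constant 1 sums to N · 1 = 0;
  -- thus `Σ δ` is -1.
  Σ-nonzero-indicator≉0 : ∀ {δ} → (∀ {x y} → x ≈ y → δ x ≈ δ y) → δ 0# ≈ 0# →
    (∀ x → ¬ (x ≈ 0#) → δ x ≈ 1#) → ¬ (Σ δ ≈ 0#)
  Σ-nonzero-indicator≉0 {δ} δ-cong δ0≈0 δx≈1 Σδ≈0 = 1≉0 (begin
    1#                                   ≈⟨ 1-δ0≈1 ⟨
    1# + - 1# * δ 0#                     ≈⟨ Σ-single 0# (λ eq → +-congˡ (*-congˡ (δ-cong eq)))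
                                             (λ x x≉0 → trans (+-congˡ (*-congˡ (δx≈1 x x≉0))) (trans (+-congˡ (*-identityʳ _)) (-‿inverseʳ 1#))) ⟨
    Σ (λ x → 1# + - 1# * δ x)            ≈⟨ Σ-+ (λ _ → 1#) (λ x → - 1# * δ x) ⟩
    Σ (λ _ → 1#) + Σ (λ x → - 1# * δ x)  ≈⟨ +-cong (trans (Sum.sum-replicate N) cardinality·1≈0) (Σ-* (- 1#) δ) ⟩
    0# + - 1# * Σ δ                      ≈⟨ trans (+-identityˡ _) (trans (*-congˡ Σδ≈0) (zeroʳ _)) ⟩
    0#                                   ∎)
    where
    1-δ0≈1 : 1# + - 1# * δ 0# ≈ 1#
    1-δ0≈1 = trans (+-congˡ (trans (*-congˡ δ0≈0) (zeroʳ _))) (+-identityʳ 1#)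

  -- Evaluates Σ δ/(w - X) and Σ δ/(w - X)² for a family w of n-th roots of
  -- unity, n = m + 2, whose lower power sums vanish; v stands for 1/(w - X).
  module ResidueSums
    (m : ℕ) (δ w v : Carrier → Carrier) (X : Carrier)
    (δw^n≈δ : ∀ x → δ x * w x ^ suc (suc m) ≈ δ x)
    (Σδw^a≈0 : ∀ a → a ℕ.≤ m → Σ (λ x → δ x * w x ^ suc a) ≈ 0#)
    (δvw≈ : ∀ x → δ x * (v x * w x) ≈ δ x * (1# + X * v x))
    where

    T U : ℕ → Carrier
    T a = Σ (λ x → δ x * w x ^ a * v x)
    U a = Σ (λ x → δ x * w x ^ a * (v x * v x))

    -- The relation v w = 1 + X v trades a factor w for a factor X, at the price of a power sum.
    T-suc : ∀ a → T (suc a) ≈ X * T a + Σ (λ x → δ x * w x ^ a)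
    T-suc a = begin
      T (suc a)                                                  ≈⟨ Σ-cong pointwise ⟩
      Σ (λ x → X * (δ x * w x ^ a * v x) + δ x * w x ^ a)        ≈⟨ Σ-+ (λ x → X * (δ x * w x ^ a * v x)) (λ x → δ x * w x ^ a) ⟩
      Σ (λ x → X * (δ x * w x ^ a * v x)) + Σ (λ x → δ x * w x ^ a)  ≈⟨ +-congʳ (Σ-* X (λ x → δ x * w x ^ a * v x)) ⟩
      X * T a + Σ (λ x → δ x * w x ^ a)                          ∎
      where
      pointwise : ∀ x → δ x * w x ^ suc a * v x ≈ X * (δ x * w x ^ a * v x) + δ x * w x ^ a
      pointwise x = begin
        δ x * (w x * w x ^ a) * v x            ≈⟨ solve 4 (λ d w u v → d :* (w :* u) :* v := d :* (v :* w) :* u) refl (δ x) (w x) (w x ^ a) (v x) ⟩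
        δ x * (v x * w x) * w x ^ a            ≈⟨ *-congʳ (δvw≈ x) ⟩
        δ x * (1# + X * v x) * w x ^ a         ≈⟨ solve 4 (λ d X u v → d :* (con (+ 1) :+ X :* v) :* u := X :* (d :* u :* v) :+ d :* u) refl (δ x) X (w x ^ a) (v x) ⟩
        X * (δ x * w x ^ a * v x) + δ x * w x ^ a  ∎

    U-suc : ∀ a → U (suc a) ≈ X * U a + T a
    U-suc a = begin
      U (suc a)                                                  ≈⟨ Σ-cong pointwise ⟩
      Σ (λ x → X * (δ x * w x ^ a * (v x * v x)) + δ x * w x ^ a * v x)        ≈⟨ Σ-+ (λ x → X * (δ x * w x ^ a * (v x * v x))) (λ x → δ x * w x ^ a * v x) ⟩
      Σ (λ x → X * (δ x * w x ^ a * (v x * v x))) + T a          ≈⟨ +-congʳ (Σ-* X (λ x → δ x * w x ^ a * (v x * v x))) ⟩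
      X * U a + T a                                              ∎
      where
      pointwise : ∀ x → δ x * w x ^ suc a * (v x * v x) ≈ X * (δ x * w x ^ a * (v x * v x)) + δ x * w x ^ a * v x
      pointwise x = begin
        δ x * (w x * w x ^ a) * (v x * v x)    ≈⟨ solve 4 (λ d w u v → d :* (w :* u) :* (v :* v) := d :* (v :* w) :* (u :* v)) refl (δ x) (w x) (w x ^ a) (v x) ⟩
        δ x * (v x * w x) * (w x ^ a * v x)    ≈⟨ *-congʳ (δvw≈ x) ⟩
        δ x * (1# + X * v x) * (w x ^ a * v x) ≈⟨ solve 4 (λ d X u v → d :* (con (+ 1) :+ X :* v) :* (u :* v) := X :* (d :* u :* (v :* v)) :+ d :* u :* v) refl (δ x) X (w x ^ a) (v x) ⟩
        X * (δ x * w x ^ a * (v x * v x)) + δ x * w x ^ a * v x  ∎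

    T-1 : T 1 ≈ X * T 0 + Σ δ
    T-1 = trans (T-suc 0) (+-congˡ (Σ-cong λ x → *-identityʳ (δ x)))

    -- The progression starts at `T 1` and not at `T 0`, because the correction at exponent 0 is
    -- `Σ δ`, which does not vanish in the application.
    T-geometric : ∀ a → a ℕ.≤ suc m → T (suc a) ≈ X ^ a * T 1
    T-geometric zero    _         = sym (*-identityˡ _)
    T-geometric (suc a) (s≤s a≤m) = begin
      T (suc (suc a))             ≈⟨ T-suc (suc a) ⟩
      X * T (suc a) + _           ≈⟨ +-cong (*-congˡ (T-geometric a (ℕₚ.m≤n⇒m≤1+n a≤m))) (Σδw^a≈0 a a≤m) ⟩
      X * (X ^ a * T 1) + 0#      ≈⟨ trans (+-identityʳ _) (sym (*-assoc _ _ _)) ⟩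
      X ^ suc a * T 1             ∎

    -- When `U-suc` is unrolled, each of T 1, ..., T (a + 1) contributes the same X^a T 1; hence the
    -- factor `suc a`.
    U-expansion : ∀ a → a ℕ.≤ m →
      U (suc (suc a)) ≈ X ^ suc (suc a) * U 0 + X ^ suc a * T 0 + suc a · 1# * (X ^ a * T 1)
    U-expansion zero    _   = begin
      U 2                                ≈⟨ U-suc 1 ⟩
      X * U 1 + T 1                      ≈⟨ +-congʳ (*-congˡ (U-suc 0)) ⟩
      X * (X * U 0 + T 0) + T 1          ≈⟨ solve 4 (λ X U₀ T₀ T₁ → X :* (X :* U₀ :+ T₀) :+ T₁ :=
                                              X :* (X :* con (+ 1)) :* U₀ :+ X :* con (+ 1) :* T₀ :+ (con (+ 1) :+ con (+ 0)) :* (con (+ 1) :* T₁))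
                                              refl X (U 0) (T 0) (T 1) ⟩
      X ^ 2 * U 0 + X ^ 1 * T 0 + 1 · 1# * (X ^ 0 * T 1)  ∎
    U-expansion (suc a) a<m = begin
      U (suc (suc (suc a)))              ≈⟨ U-suc (suc (suc a)) ⟩
      X * U (suc (suc a)) + T (suc (suc a))
        ≈⟨ +-cong (*-congˡ (U-expansion a (ℕₚ.<⇒≤ a<m))) (T-geometric (suc a) (s≤s (ℕₚ.<⇒≤ a<m))) ⟩
      X * (X ^ suc (suc a) * U 0 + X ^ suc a * T 0 + suc a · 1# * (X ^ a * T 1)) + X ^ suc a * T 1
        ≈⟨ solve 6 (λ X Q k U₀ T₀ T₁ →
             X :* (X :* (X :* Q) :* U₀ :+ X :* Q :* T₀ :+ k :* (Q :* T₁)) :+ X :* Q :* T₁ :=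
             X :* (X :* (X :* Q)) :* U₀ :+ X :* (X :* Q) :* T₀ :+ (con (+ 1) :+ k) :* (X :* Q :* T₁))
             refl X (X ^ a) (suc a · 1#) (U 0) (T 0) (T 1) ⟩
      X ^ suc (suc (suc a)) * U 0 + X ^ suc (suc a) * T 0 + suc (suc a) · 1# * (X ^ suc a * T 1)  ∎

    -- As w^n = 1, the recursion returns to its start after n steps and becomes a linear equation;
    -- likewise for `U`.
    T-0 : T 0 ≈ X ^ suc m * T 1
    T-0 = trans (Σ-cong λ x → *-congʳ {v x} (trans (*-identityʳ _) (sym (δw^n≈δ x)))) (T-geometric (suc m) ℕₚ.≤-refl)

    U-0 : U 0 ≈ X ^ suc (suc m) * U 0 + X ^ suc m * T 0 + suc m · 1# * (X ^ m * T 1)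
    U-0 = trans (Σ-cong λ x → *-congʳ {v x * v x} (trans (*-identityʳ _) (sym (δw^n≈δ x)))) (U-expansion m ℕₚ.≤-refl)

    -- The closed recursion for `T` reads (1 - X^n) T 0 = X^(n-1) Σ δ, and its right side is
    -- nonzero.
    X^n≉1 : ¬ (X ≈ 0#) → ¬ (Σ δ ≈ 0#) → ¬ (X ^ suc (suc m) ≈ 1#)
    X^n≉1 X≉0 Σδ≉0 X^n≈1 = *-≉0 (^-≉0 X≉0 (suc m)) Σδ≉0 (begin
      X ^ suc m * Σ δ                            ≈⟨ solve 4 (λ X Q S T₀ → Q :* S := Q :* (X :* T₀ :+ S) :- X :* Q :* T₀) refl X (X ^ suc m) (Σ δ) (T 0) ⟩
      X ^ suc m * (X * T 0 + Σ δ) - X ^ suc (suc m) * T 0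
        ≈⟨ +-cong (*-congˡ (sym T-1)) (-‿cong (*-congʳ X^n≈1)) ⟩
      X ^ suc m * T 1 - 1# * T 0                 ≈⟨ +-cong (sym T-0) (-‿cong (*-identityˡ _)) ⟩
      T 0 - T 0                                  ≈⟨ -‿inverseʳ _ ⟩
      0#                                         ∎)

    X^n-equation : ¬ (X ≈ 0#) → ¬ (Σ δ ≈ 0#) →
      (X * X + 1#) * T 0 + X * (X * X - 1#) * U 0 ≈ 0# →
      (X * X + 1#) * (1# - X ^ suc (suc m)) + (X * X - 1#) * (X ^ suc (suc m) + suc m · 1#) ≈ 0#
    X^n-equation X≉0 Σδ≉0 h≈0 =
      *-cancel-≉0 (*-≉0 (*-≉0 X≉0 Σδ≉0) (^-≉0 X≉0 m)) (begin
        X * S * P * ((X * X + 1#) * (1# - X * (X * P)) + (X * X - 1#) * (X * (X * P) + k))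
          -- The closed recursions `f` and `g` determine (1 - Y) T 0 and (1 - Y)² U 0 as multiples
          -- of `S`, so subtracting multiples of them from (1 - Y)² h eliminates `T 0` and `U 0`. In
          -- this form nothing is divided by 1 - Y.
          ≈⟨ solve 6 (λ X P k S T₀ U₀ →
               let one = con (+ 1)
                   Y   = X :* (X :* P)
                   f   = T₀ :- X :* P :* (X :* T₀ :+ S)
                   g   = U₀ :- (Y :* U₀ :+ X :* P :* T₀ :+ k :* (P :* (X :* T₀ :+ S)))
                   h   = (X :* X :+ one) :* T₀ :+ X :* (X :* X :- one) :* U₀
               in  X :* S :* P :* ((X :* X :+ one) :* (one :- Y) :+ (X :* X :- one) :* (Y :+ k)) :=
                   (one :- Y) :* (one :- Y) :* h
                   :- ((X :* X :+ one) :* (one :- Y) :* f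
                       :+ X :* (X :* X :- one) :* ((one :- Y) :* g :+ (one :+ k) :* X :* P :* f)))
               refl X P k S (T 0) (U 0) ⟩
        (1# - Y) * (1# - Y) * h - ((X * X + 1#) * (1# - Y) * f + X * (X * X - 1#) * ((1# - Y) * g + (1# + k) * X * P * f))
          ≈⟨ +-cong (*-congˡ h≈0) (-‿cong (+-cong (*-congˡ f≈0) (*-congˡ (+-cong (*-congˡ g≈0) (*-congˡ f≈0))))) ⟩
        (1# - Y) * (1# - Y) * 0# - ((X * X + 1#) * (1# - Y) * 0# + X * (X * X - 1#) * ((1# - Y) * 0# + (1# + k) * X * P * 0#))
          ≈⟨ solve 5 (λ a b c d e → a :* con (+ 0) :- (b :* con (+ 0) :+ c :* (d :* con (+ 0) :+ e :* con (+ 0))) := con (+ 0)) refl _ _ _ _ _ ⟩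
        0# ∎)
      where
      S = Σ δ
      P = X ^ m
      Y = X * (X * P)
      k = suc m · 1#
      f = T 0 - X * P * (X * T 0 + S)
      g = U 0 - (Y * U 0 + X * P * T 0 + k * (P * (X * T 0 + S)))
      h = (X * X + 1#) * T 0 + X * (X * X - 1#) * U 0
      f≈0 : f ≈ 0#
      f≈0 = x≈y⇒x-y≈0 (trans T-0 (*-congˡ T-1))
      g≈0 : g ≈ 0#
      g≈0 = x≈y⇒x-y≈0 (trans U-0 (+-congˡ (*-congˡ (*-congˡ T-1))))

-- The quadratic extension: conjugation, cube roots of unity, powers of -3

module _ where
  open +-*-Solver

  -- Exhibits (q² - 1)/3 as a successor, the form that `cube-root-of-unity` takes.
  [4+3j]²≡ : ∀ j → (1 ℕ.+ 3 ℕ.* suc j) ℕ.* ((1 ℕ.+ 3 ℕ.* suc j) ℕ.* 1) ≡ 1 ℕ.+ suc (4 ℕ.+ (8 ℕ.+ 3 ℕ.* j) ℕ.* j) ℕ.* 3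
  [4+3j]²≡ = solve 1 (λ j → (con 1 :+ con 3 :* (con 1 :+ j)) :* ((con 1 :+ con 3 :* (con 1 :+ j)) :* con 1) :=
    con 1 :+ (con 5 :+ (con 8 :+ con 3 :* j) :* j) :* con 3) ≡.refl

  [2+3j]²≡ : ∀ j → (2 ℕ.+ 3 ℕ.* j) ℕ.* ((2 ℕ.+ 3 ℕ.* j) ℕ.* 1) ≡ 1 ℕ.+ suc ((4 ℕ.+ 3 ℕ.* j) ℕ.* j) ℕ.* 3
  [2+3j]²≡ = solve 1 (λ j → (con 2 :+ con 3 :* j) :* ((con 2 :+ con 3 :* j) :* con 1) :=
    con 1 :+ (con 1 :+ (con 4 :+ con 3 :* j) :* j) :* con 3) ≡.refl

module QuadraticExtension (K : Field c ℓ) (e : ℕ) (K-card : HasCardinality K (suc e ℕ.^ 2))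
  (p k : ℕ) (p-prime : Prime p) (q≡p^k : suc e ≡ p ℕ.^ k) where

  open FieldProperties K public
  open FiniteField K (suc e ℕ.^ 2) K-card public

  q : ℕ
  q = suc e

  char≈0 : p · 1# ≈ 0#
  char≈0 = p·1≈0 p (k ℕ.* 2) (≡.trans (≡.cong (ℕ._^ 2) q≡p^k) (ℕₚ.^-*-assoc p k 2))

  open Frobenius p p-prime char≈0 public

  φ : Carrier → Carrier
  φ x = x ^ q

  φ-cong : ∀ {x y} → x ≈ y → φ x ≈ φ y
  φ-cong = ^-congˡ q

  φ-+ : ∀ x y → φ (x + y) ≈ φ x + φ y
  φ-+ x y = ≡.subst (λ n → (x + y) ^ n ≈ x ^ n + y ^ n) (≡.sym q≡p^k) (^p^k-distrib-+ k x y)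

  φ-* : ∀ x y → φ (x * y) ≈ φ x * φ y
  φ-* x y = ^-distrib-* x y q

  φ-1 : φ 1# ≈ 1#
  φ-1 = 1^n≈1 q

  φ-neg : ∀ x → φ (- x) ≈ - φ x
  φ-neg x = begin
    φ (- x)                 ≈⟨ solve 2 (λ a b → a := (b :+ a) :- b) refl (φ (- x)) (φ x) ⟩
    φ x + φ (- x) - φ x     ≈⟨ +-congʳ (φ-+ x (- x)) ⟨
    φ (x - x) - φ x         ≈⟨ +-congʳ (trans (φ-cong (-‿inverseʳ x)) (0^[1+n]≈0 e)) ⟩
    0# - φ x                ≈⟨ +-identityˡ _ ⟩
    - φ x                   ∎

  φ-sub : ∀ x y → φ (x - y) ≈ φ x - φ y
  φ-sub x y = trans (φ-+ x (- y)) (+-congˡ (φ-neg y))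

  φ-involutive : ∀ x → φ (φ x) ≈ x
  φ-involutive x = trans (^-assocʳ x q q)
    (trans (^-congʳ x (≡.cong (q ℕ.*_) (≡.sym (ℕₚ.*-identityʳ q)))) (x^cardinality≈x x))

  -- For x ≠ 0 this is an element of μ_{q+1}, on which φ is inversion.
  unit : Carrier → Carrier
  unit x = x ^ e

  unit-φ : ∀ {x} → ¬ (x ≈ 0#) → unit x * φ (unit x) ≈ 1#
  unit-φ {x} x≉0 = *-cancelˡ-≉0 x≉0 (begin
    x * (unit x * φ (unit x))   ≈⟨ *-assoc x _ _ ⟨
    φ x * φ (unit x)            ≈⟨ φ-* x (unit x) ⟨
    φ (φ x)                     ≈⟨ φ-involutive x ⟩
    x                           ≈⟨ *-identityʳ x ⟨
    x * 1#                      ∎)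

  q·1≈0 : q · 1# ≈ 0#
  q·1≈0 = ^≈0⇒≈0 2 (trans (*-congˡ (*-identityʳ _))
    (trans (sym (×1-homo-* q q)) (trans (×-congˡ (≡.cong (q ℕ.*_) (≡.sym (ℕₚ.*-identityʳ q)))) cardinality·1≈0)))

  -- Since q vanishes in K, a vanishing d would make the residue of q modulo d vanish too; this is
  -- how 2 and 3 are seen to be nonzero.
  residue·1≈0 : ∀ r j d → q ≡ r ℕ.+ d ℕ.* j → d · 1# ≈ 0# → r · 1# ≈ 0#
  residue·1≈0 r j d q≡ d≈0 = begin
    r · 1#                        ≈⟨ +-identityʳ _ ⟨
    r · 1# + 0#                   ≈⟨ +-congˡ (trans (×1-homo-* d j) (trans (*-congʳ d≈0) (zeroˡ _))) ⟨
    r · 1# + (d ℕ.* j) · 1#       ≈⟨ ×-homo-+ 1# r (d ℕ.* j) ⟨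
    (r ℕ.+ d ℕ.* j) · 1#          ≡⟨ ≡.cong (_· 1#) q≡ ⟨
    q · 1#                        ≈⟨ q·1≈0 ⟩
    0#                            ∎

  1·1≉0 : ¬ (1 · 1# ≈ 0#)
  1·1≉0 = 1≉0 ∘ trans (sym (×-homo-1 1#))

  2≉0 : ∀ h → q ≡ 1 ℕ.+ 2 ℕ.* h → ¬ (2 · 1# ≈ 0#)
  2≉0 h q≡ = 1·1≉0 ∘ residue·1≈0 1 h 2 q≡

  3≉0-1 : ∀ j → q ≡ 1 ℕ.+ 3 ℕ.* j → ¬ (3 · 1# ≈ 0#)
  3≉0-1 j q≡ = 1·1≉0 ∘ residue·1≈0 1 j 3 q≡

  3≉0-2 : ∀ j → q ≡ 2 ℕ.+ 3 ℕ.* j → ¬ (3 · 1# ≈ 0#)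
  3≉0-2 j q≡ 3≈0 = 1≉0 (begin
    1#                  ≈⟨ solve 0 (con (+ 1) := con (+ 3) :- con (+ 2)) refl ⟩
    3 · 1# - 2 · 1#     ≈⟨ +-cong 3≈0 (-‿cong (residue·1≈0 2 j 3 q≡ 3≈0)) ⟩
    0# - 0#             ≈⟨ -‿inverseʳ 0# ⟩
    0#                  ∎)

  -- Here q² - 1 is three times `suc d`, so `x ^ suc d` has cube 1 for every nonzero x; an x for
  -- which this power is not 1 makes it primitive.
  cube-root-of-unity : ∀ d → q ℕ.* (q ℕ.* 1) ≡ 1 ℕ.+ suc d ℕ.* 3 → ∃[ ω ] ω ^ 3 ≈ 1# × ω * ω + ω + 1# ≈ 0#
  cube-root-of-unity d N≡ = let x , x≉0 , x^d≉1 = ∃-x^d≉1 d 2+d<N in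
    x ^ suc d , ω³≈1 x≉0 , *-cancel-≉0 (x^d≉1 ∘ x-y≈0⇒x≈y) (trans
      (solve 1 (λ ω → (ω :- con (+ 1)) :* (ω :* ω :+ ω :+ con (+ 1)) := ω :* (ω :* (ω :* con (+ 1))) :- con (+ 1)) refl (x ^ suc d))
      (x≈y⇒x-y≈0 (ω³≈1 x≉0)))
    where
    2+d<N : suc (suc d) ℕ.< q ℕ.* (q ℕ.* 1)
    2+d<N rewrite N≡ = s≤s (s≤s (s≤s (ℕₚ.m≤n⇒m≤1+n (ℕₚ.m≤m*n d 3))))
    ω³≈1 : ∀ {x} → ¬ (x ≈ 0#) → (x ^ suc d) ^ 3 ≈ 1#
    ω³≈1 {x} x≉0 = trans (^-assocʳ x (suc d) 3) (*-cancelˡ-≉0 x≉0 (trans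
      (trans (^-congʳ x (≡.sym N≡)) (x^cardinality≈x x)) (sym (*-identityʳ x))))

  -3# : Carrier
  -3# = - (3 · 1#)

  √-3 : ∀ {ω} → ω * ω + ω + 1# ≈ 0# → (ω - ω * ω) * (ω - ω * ω) ≈ -3#
  √-3 {ω} E≈0 = x-y≈0⇒x≈y (begin
    (ω - ω * ω) * (ω - ω * ω) - -3#
      ≈⟨ solve 1 (λ w → (w :- w :* w) :* (w :- w :* w) :- con -[1+ 2 ] :=
           (w :* w :+ w :+ con (+ 1)) :* (w :* w :- con (+ 3) :* w :+ con (+ 3))) refl ω ⟩
    (ω * ω + ω + 1#) * (ω * ω - 3 · 1# * ω + 3 · 1#)   ≈⟨ trans (*-congʳ E≈0) (zeroˡ _) ⟩
    0#  ∎)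

  ω^[r+3j] : ∀ {ω} r j → ω ^ 3 ≈ 1# → ω ^ (r ℕ.+ 3 ℕ.* j) ≈ ω ^ r
  ω^[r+3j] {ω} r j ω³≈1 = begin
    ω ^ (r ℕ.+ 3 ℕ.* j)       ≈⟨ ^-homo-* ω r _ ⟩
    ω ^ r * ω ^ (3 ℕ.* j)     ≈⟨ *-congˡ (^-assocʳ ω 3 j) ⟨
    ω ^ r * (ω ^ 3) ^ j       ≈⟨ *-congˡ (trans (^-congˡ j ω³≈1) (1^n≈1 j)) ⟩
    ω ^ r * 1#                ≈⟨ *-identityʳ _ ⟩
    ω ^ r                     ∎

  -- Euler's criterion in disguise: φ scales x by the h-th power of its square, h = (q-1)/2, so the
  -- action of φ on a square root of κ reveals κ^h.
  φ≈*[x²]^h : ∀ h → q ≡ 1 ℕ.+ 2 ℕ.* h → ∀ x → φ x ≈ x * (x * x) ^ h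
  φ≈*[x²]^h h q≡ x = begin
    x ^ q                   ≡⟨ ≡.cong (x ^_) q≡ ⟩
    x * x ^ (2 ℕ.* h)       ≈⟨ *-congˡ (^-assocʳ x 2 h) ⟨
    x * (x ^ 2) ^ h         ≈⟨ *-congˡ (^-congˡ h (*-congˡ (*-identityʳ x))) ⟩
    x * (x * x) ^ h         ∎

  square-root-≉0 : ∀ {θ a} → ¬ (a ≈ 0#) → θ * θ ≈ - a → ¬ (θ ≈ 0#)
  square-root-≉0 {θ} {a} a≉0 θ²≈ θ≈0 = a≉0 (trans (sym (-‿involutive a))
    (trans (-‿cong (trans (sym θ²≈) (trans (*-congʳ θ≈0) (zeroˡ θ)))) -0#≈0#))

  -- With θ = ω - ω² one has θ² = -3, so (-3)^h = θ^(q-1); and φ fixes or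
  -- swaps the two primitive cube roots of unity according to q mod 3.
  [-3]^h≈1 : ∀ h j → q ≡ 1 ℕ.+ 2 ℕ.* h → q ≡ 1 ℕ.+ 3 ℕ.* j → -3# ^ h ≈ 1#
  [-3]^h≈1 h zero q≡2h q≡1 = contradiction (trans (×-congˡ (≡.sym q≡1)) q·1≈0) 1·1≉0
  [-3]^h≈1 h (suc j) q≡2h q≡3j =
    let ω , ω³≈1 , E≈0 = cube-root-of-unity (4 ℕ.+ (8 ℕ.+ 3 ℕ.* j) ℕ.* j) (≡.trans (≡.cong (λ n → n ℕ.* (n ℕ.* 1)) q≡3j)
          ([4+3j]²≡ j))
        θ = ω - ω * ω
        φω≈ω = trans (^-congʳ ω q≡3j) (trans (ω^[r+3j] 1 (suc j) ω³≈1) (*-identityʳ ω))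
    in *-cancelˡ-≉0 (square-root-≉0 (3≉0-1 (suc j) q≡3j) (√-3 E≈0)) (begin
      θ * -3# ^ h          ≈⟨ *-congˡ (^-congˡ h (√-3 E≈0)) ⟨
      θ * (θ * θ) ^ h      ≈⟨ φ≈*[x²]^h h q≡2h θ ⟨
      φ θ                  ≈⟨ φ-sub ω (ω * ω) ⟩
      φ ω - φ (ω * ω)      ≈⟨ +-cong φω≈ω (-‿cong (trans (φ-* ω ω) (*-cong φω≈ω φω≈ω))) ⟩
      θ                    ≈⟨ *-identityʳ θ ⟨
      θ * 1#               ∎)

  [-3]^h≈-1 : ∀ h j → q ≡ 1 ℕ.+ 2 ℕ.* h → q ≡ 2 ℕ.+ 3 ℕ.* j → -3# ^ h ≈ - 1#
  [-3]^h≈-1 h j q≡2h q≡3j =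
    let ω , ω³≈1 , E≈0 = cube-root-of-unity ((4 ℕ.+ 3 ℕ.* j) ℕ.* j) (≡.trans (≡.cong (λ n → n ℕ.* (n ℕ.* 1)) q≡3j)
          ([2+3j]²≡ j))
        θ = ω - ω * ω
        φω≈ω² = trans (^-congʳ ω q≡3j) (trans (ω^[r+3j] 2 j ω³≈1) (*-congˡ (*-identityʳ ω)))
    in *-cancelˡ-≉0 (square-root-≉0 (3≉0-2 j q≡3j) (√-3 E≈0)) (begin
      θ * -3# ^ h              ≈⟨ *-congˡ (^-congˡ h (√-3 E≈0)) ⟨
      θ * (θ * θ) ^ h          ≈⟨ φ≈*[x²]^h h q≡2h θ ⟨
      φ θ                      ≈⟨ φ-sub ω (ω * ω) ⟩
      φ ω - φ (ω * ω)          ≈⟨ +-cong φω≈ω² (-‿cong (trans (φ-* ω ω) (*-cong φω≈ω² φω≈ω²))) ⟩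
      ω * ω - ω * ω * (ω * ω)  ≈⟨ solve 1 (λ w → w :* w :- w :* w :* (w :* w) := w :* w :- w :* (w :* (w :* con (+ 1))) :* w) refl ω ⟩
      ω * ω - ω ^ 3 * ω        ≈⟨ +-congˡ (-‿cong (trans (*-congʳ ω³≈1) (*-identityˡ ω))) ⟩
      ω * ω - ω                ≈⟨ solve 1 (λ w → w :* w :- w := (w :- w :* w) :* (:- con (+ 1))) refl ω ⟩
      θ * - 1#                 ∎)

-- The map induced by the binomial

module _ where
  open +-*-Solver

  -- With q = r + 3, the exponents (q - 1) b for b up to q stay below q² - 1, as `∃-x^d≉1` demands.
  1+[1+e]*≤⇒< : ∀ r b → b ℕ.≤ suc (suc (suc r)) → suc (suc (suc r) ℕ.* b) ℕ.< suc (suc (suc r)) ℕ.^ 2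
  1+[1+e]*≤⇒< r b b≤q = ℕₚ.≤-trans (s≤s (s≤s (ℕₚ.*-monoʳ-≤ (suc (suc r)) b≤q)))
    (ℕₚ.≤-trans (ℕₚ.m≤n+m _ (suc r)) (ℕₚ.≤-reflexive
      (solve 1 (λ r → con 1 :+ r :+ (con 2 :+ (con 2 :+ r) :* (con 3 :+ r)) := (con 3 :+ r) :* ((con 3 :+ r) :* con 1)) ≡.refl r)))

module BinomialMaps (K : Field c ℓ) (r : ℕ) (K-card : HasCardinality K (suc (suc (suc r)) ℕ.^ 2))
  (p k : ℕ) (p-prime : Prime p) (q≡p^k : suc (suc (suc r)) ≡ p ℕ.^ k) where

  open QuadraticExtension K (suc (suc r)) K-card p k p-prime q≡p^k public

  module BinomialMap
    (τ : Carrier) (τ≉0 : ¬ (τ ≈ 0#)) (φτ≈τ : φ τ ≈ τ)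
    (f : Carrier → Carrier) (f-cong : ∀ {x y} → x ≈ y → f x ≈ f y) (f0≈0 : f 0# ≈ 0#)
    (x*f≈ : ∀ x → x * f x ≈ unit x + τ * φ (unit x))
    where

    e : ℕ
    e = suc (suc r)

    unit-cong : ∀ {x y} → x ≈ y → unit x ≈ unit y
    unit-cong = ^-congˡ e

    unit-≉0 : ∀ {x} → ¬ (x ≈ 0#) → ¬ (unit x ≈ 0#)
    unit-≉0 x≉0 = ^-≉0 x≉0 e

    w : Carrier → Carrier
    w x = unit x * unit x

    w+τ≈ : ∀ {x} → ¬ (x ≈ 0#) → w x + τ ≈ unit x * (x * f x)
    w+τ≈ {x} x≉0 = begin
      y * y + τ                  ≈⟨ +-congˡ (trans (*-congˡ (unit-φ x≉0)) (*-identityʳ τ)) ⟨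
      y * y + τ * (y * φ y)      ≈⟨ solve 3 (λ y z t → y :* y :+ t :* (y :* z) := y :* (y :+ t :* z)) refl y (φ y) τ ⟩
      y * (y + τ * φ y)          ≈⟨ *-congˡ (x*f≈ x) ⟨
      y * (x * f x)              ∎
      where y = unit x

    φ[y+τφy]≈ : ∀ y → φ (y + τ * φ y) ≈ φ y + τ * y
    φ[y+τφy]≈ y = trans (φ-+ _ _) (+-congˡ (trans (φ-* _ _) (*-cong φτ≈τ (φ-involutive y))))

    -- Conjugating x f(x) computes f(x)^(q-1), because φ is multiplicative and `unit` times its
    -- argument is φ; on the other side φ swaps y and φ y and fixes τ.
    unit-f : ∀ {x} → ¬ (x ≈ 0#) → (w x + τ) * unit (f x) ≈ φ (unit x) + τ * unit x
    unit-f {x} x≉0 = begin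
      (w x + τ) * unit (f x)                  ≈⟨ *-congʳ (w+τ≈ x≉0) ⟩
      unit x * (x * f x) * unit (f x)         ≈⟨ solve 4 (λ y x f g → y :* (x :* f) :* g := x :* y :* (f :* g)) refl _ x (f x) _ ⟩
      φ x * φ (f x)                           ≈⟨ φ-* x (f x) ⟨
      φ (x * f x)                             ≈⟨ φ-cong (x*f≈ x) ⟩
      φ (unit x + τ * φ (unit x))             ≈⟨ φ[y+τφy]≈ (unit x) ⟩
      φ (unit x) + τ * unit x                 ∎

    -- Necessity: the power sum with exponent 2(q - 1)

    module PowerSums (f-bijective : Bijective _≈_ _≈_ f) where

      w+τ≉0 : ∀ {x} → ¬ (x ≈ 0#) → ¬ (w x + τ ≈ 0#)
      w+τ≉0 {x} x≉0 w+τ≈0 = *-≉0 (unit-≉0 x≉0) (*-≉0 x≉0 fx≉0) (trans (sym (w+τ≈ x≉0)) w+τ≈0)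
        where
        fx≉0 : ¬ (f x ≈ 0#)
        fx≉0 fx≈0 = x≉0 (proj₁ f-bijective (trans fx≈0 (sym f0≈0)))

      -- `δ x` is x^(q²-1), the indicator of the nonzero elements. As a monomial it respects
      -- equality and is invariant under nonzero scaling without a case distinction.
      δ v : Carrier → Carrier
      δ x = unit x * φ (unit x)
      v x = recip (w x + τ)

      δ-cong : ∀ {x y} → x ≈ y → δ x ≈ δ y
      δ-cong x≈y = *-cong (unit-cong x≈y) (φ-cong (unit-cong x≈y))

      δ-0 : ∀ {x} → x ≈ 0# → δ x ≈ 0#
      δ-0 x≈0 = trans (*-congʳ (trans (unit-cong x≈0) (0^[1+n]≈0 (suc r)))) (zeroˡ _)

      Σδ≉0 : ¬ (Σ δ ≈ 0#)
      Σδ≉0 = Σ-nonzero-indicator≉0 δ-cong (δ-0 refl) (λ x → unit-φ)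

      -τ≉0 : ¬ (- τ ≈ 0#)
      -τ≉0 -τ≈0 = τ≉0 (trans (sym (-‿involutive τ)) (trans (-‿cong -τ≈0) -0#≈0#))

      δvw≈ : ∀ x → δ x * (v x * w x) ≈ δ x * (1# + - τ * v x)
      δvw≈ x = go (x ≟ 0#)
        where
        go : Dec (x ≈ 0#) → _
        go (yes x≈0) = trans (*-congʳ (δ-0 x≈0)) (trans (zeroˡ _)
          (sym (trans (*-congʳ (δ-0 x≈0)) (zeroˡ _))))
        go (no  x≉0) = *-congˡ (begin
          v x * w x                       ≈⟨ solve 3 (λ v w t → v :* w := (w :+ t) :* v :+ :- t :* v) refl (v x) (w x) τ ⟩
          (w x + τ) * v x + - τ * v x     ≈⟨ +-congʳ (*-recip (w+τ≉0 x≉0)) ⟩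
          1# + - τ * v x                  ∎)

      -- The permutation `f` can be substituted away, leaving a power sum with positive exponent
      -- below q² - 1.
      Σ-unit[f]²≈0 : Σ (λ x → unit (f x) * unit (f x)) ≈ 0#
      Σ-unit[f]²≈0 = begin
        Σ (w ∘ f)          ≈⟨ Σ-reindex (λ x≈y → *-cong (unit-cong x≈y) (unit-cong x≈y)) f-bijective ⟩
        Σ w                ≈⟨ Σ-cong (λ x → ^-homo-* x e e) ⟨
        Σ (_^ (e ℕ.+ e))   ≈⟨ Σ-^≈0 (suc r ℕ.+ e) (≡.subst (λ n → suc n ℕ.< q ℕ.^ 2) e*2≡e+e (1+[1+e]*≤⇒< r 2 (s≤s (s≤s z≤n))))  ⟩
        0#                 ∎
        where
        e*2≡e+e : e ℕ.* 2 ≡ e ℕ.+ e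
        e*2≡e+e = ≡.trans (ℕₚ.*-comm e 2) (≡.cong (e ℕ.+_) (ℕₚ.+-identityʳ e))

      module _ (m : ℕ)
        (w^n≈1 : ∀ {x} → ¬ (x ≈ 0#) → w x ^ suc (suc m) ≈ 1#)
        (∃-w^a≉1 : ∀ a → a ℕ.≤ m → ∃[ b ] ¬ (b ≈ 0#) × ¬ (w b ^ suc a ≈ 1#))
        where

        private
          δw^n≈δ : ∀ x → δ x * w x ^ suc (suc m) ≈ δ x
          δw^n≈δ x with x ≟ 0#
          ... | yes x≈0 = trans (*-congʳ (δ-0 x≈0)) (trans (zeroˡ _) (sym (δ-0 x≈0)))
          ... | no  x≉0 = trans (*-congˡ (w^n≈1 x≉0)) (*-identityʳ _)

          Σδw^a≈0 : ∀ a → a ℕ.≤ m → Σ (λ x → δ x * w x ^ suc a) ≈ 0#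
          Σδw^a≈0 a a≤m = let b , b≉0 , w^a≉1 = ∃-w^a≉1 a a≤m in
            Σ-eigenfunction≈0 (λ x≈y → *-cong (δ-cong x≈y) (^-congˡ (suc a) (*-cong (unit-cong x≈y) (unit-cong x≈y))))
              b≉0 w^a≉1 (λ x → eigen b≉0 x)
            where
            unit-* : ∀ x y → unit (x * y) ≈ unit x * unit y
            unit-* x y = ^-distrib-* x y e
            eigen : ∀ {b} → ¬ (b ≈ 0#) → ∀ x → δ (b * x) * w (b * x) ^ suc a ≈ w b ^ suc a * (δ x * w x ^ suc a)
            eigen {b} b≉0 x = begin
              unit (b * x) * φ (unit (b * x)) * w (b * x) ^ suc a
                ≈⟨ *-cong (*-cong (unit-* b x) (trans (φ-cong (unit-* b x)) (φ-* _ _)))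
                     (^-congˡ (suc a) (trans (*-cong (unit-* b x) (unit-* b x))
                       (solve 2 (λ y z → y :* z :* (y :* z) := y :* y :* (z :* z)) refl (unit b) (unit x)))) ⟩
              unit b * unit x * (φ (unit b) * φ (unit x)) * (w b * w x) ^ suc a
                ≈⟨ *-cong (solve 4 (λ y z s t → y :* z :* (s :* t) := y :* s :* (z :* t)) refl (unit b) (unit x) _ _)
                     (^-distrib-* (w b) (w x) (suc a)) ⟩
              δ b * δ x * (w b ^ suc a * w x ^ suc a)
                ≈⟨ *-congʳ (trans (*-congʳ (unit-φ b≉0)) (*-identityˡ _)) ⟩
              δ x * (w b ^ suc a * w x ^ suc a)
                ≈⟨ solve 3 (λ d s t → d :* (s :* t) := s :* (d :* t)) refl (δ x) _ _ ⟩
              w b ^ suc a * (δ x * w x ^ suc a)  ∎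

        open ResidueSums m δ w v (- τ) δw^n≈δ Σδw^a≈0 δvw≈

        [-τ]^n≉1 : ¬ ((- τ) ^ suc (suc m) ≈ 1#)
        [-τ]^n≉1 = X^n≉1 -τ≉0 Σδ≉0

        private
          -- For nonzero x, t² times the square of `unit (f x)` is t² (1 + t w)²/(w (w + t)²), with
          -- partial fractions 1/w + A/(w + t) + B/(w + t)².
          A B : Carrier
          A = (τ * τ + 1#) * (τ * τ - 1#)
          B = - (τ * ((τ * τ - 1#) * (τ * τ - 1#)))

          -- The term 1/w is written as w^(n-1), so that its sum is one of the vanishing power sums.
          -- The factors `1#` are the zeroth powers of w in `T 0` and `U 0`.
          partial-fractions : ∀ x → τ * τ * (unit (f x) * unit (f x)) ≈
            δ x * w x ^ suc m + A * (δ x * 1# * v x) + B * (δ x * 1# * (v x * v x))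
          partial-fractions x = go (x ≟ 0#)
            where
            go : Dec (x ≈ 0#) → _
            go (yes x≈0) = begin
              τ * τ * (unit (f x) * unit (f x))
                ≈⟨ *-congˡ (*-congˡ (trans (unit-cong (trans (f-cong x≈0) f0≈0)) (0^[1+n]≈0 (suc r)))) ⟩
              τ * τ * (unit (f x) * 0#)
                ≈⟨ solve 7 (λ t g W A B o v → t :* t :* (g :* con (+ 0)) := con (+ 0) :* W :+ A :* (con (+ 0) :* o :* v) :+ B :* (con (+ 0) :* o :* (v :* v)))
                     refl τ (unit (f x)) (w x ^ suc m) A B 1# (v x) ⟩
              0# * w x ^ suc m + A * (0# * 1# * v x) + B * (0# * 1# * (v x * v x))
                ≈⟨ +-cong (+-cong (*-congʳ (δ-0 x≈0)) (*-congˡ (*-congʳ (*-congʳ (δ-0 x≈0))))) (*-congˡ (*-congʳ (*-congʳ (δ-0 x≈0)))) ⟨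
              δ x * w x ^ suc m + A * (δ x * 1# * v x) + B * (δ x * 1# * (v x * v x)) ∎
            go (no x≉0) = sym (begin
              δ x * W + A * (δ x * 1# * V) + B * (δ x * 1# * (V * V))
                ≈⟨ +-cong (+-cong (*-cong δ≈1 W≈) (*-congˡ (*-congʳ (*-congʳ δ≈1)))) (*-congˡ (*-congʳ (*-congʳ δ≈1))) ⟩
              1# * (z * z) + A * (1# * 1# * V) + B * (1# * 1# * (V * V))
                -- Factors u = (w + t) V = 1 bring all terms over the common denominator (w + t)².
                -- The relation y z = 1 enters afterwards and leaves a multiple of y z - 1.
                ≈⟨ +-congʳ (+-cong
                     (trans (*-identityˡ _) (sym (trans (*-congˡ (trans (*-cong u≈1 u≈1) (*-identityˡ _))) (*-identityʳ _))))
                     (*-congˡ (*-congˡ (sym (trans (*-congʳ u≈1) (*-identityˡ V)))))) ⟩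
              z * z * (u * u) + A * (1# * 1# * (u * V)) + B * (1# * 1# * (V * V))
                ≈⟨ solve 4 (λ y z V t →
                     let one = con (+ 1)
                         d = y :* z
                         u = (y :* y :+ t) :* V
                         A = (t :* t :+ one) :* (t :* t :- one)
                         B = :- (t :* ((t :* t :- one) :* (t :* t :- one)))
                     in z :* z :* (u :* u) :+ A :* (one :* one :* (u :* V)) :+ B :* (one :* one :* (V :* V)) :=
                        V :* V :* (d :* d :* (y :* y) :+ con (+ 2) :* t :* (d :* d) :+ t :* t :* (z :* z)
                          :+ (A :* (y :* y :+ t) :+ B)))
                     refl y z V τ ⟩
              V * V * (δ x * δ x * (y * y) + 2 · 1# * τ * (δ x * δ x) + τ * τ * (z * z) + (A * (y * y + τ) + B))
                ≈⟨ *-congˡ (+-congʳ (+-congʳ (+-cong (*-congʳ δδ≈1) (*-congˡ (trans δδ≈1 (sym δ≈1)))))) ⟩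
              V * V * (1# * (y * y) + 2 · 1# * τ * δ x + τ * τ * (z * z) + (A * (y * y + τ) + B))
                ≈⟨ solve 4 (λ y z V t →
                     let one = con (+ 1)
                         d = y :* z
                         A = (t :* t :+ one) :* (t :* t :- one)
                         B = :- (t :* ((t :* t :- one) :* (t :* t :- one)))
                     in V :* V :* (one :* (y :* y) :+ con (+ 2) :* t :* d :+ t :* t :* (z :* z)
                          :+ (A :* (y :* y :+ t) :+ B)) :=
                        t :* t :* ((z :+ t :* y) :* V :* ((z :+ t :* y) :* V))
                        :+ V :* V :* (con (+ 2) :* t :* (one :- t :* t) :* (d :- one)))
                     refl y z V τ ⟩
              τ * τ * ((z + τ * y) * V * ((z + τ * y) * V)) + V * V * (2 · 1# * τ * (1# - τ * τ) * (δ x - 1#))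
                ≈⟨ +-cong (*-congˡ (*-cong G≈ G≈)) (trans (*-congˡ (trans (*-congˡ (x≈y⇒x-y≈0 δ≈1)) (zeroʳ _))) (zeroʳ _)) ⟩
              τ * τ * (unit (f x) * unit (f x)) + 0#
                ≈⟨ +-identityʳ _ ⟩
              τ * τ * (unit (f x) * unit (f x)) ∎)
              where
              y = unit x
              z = φ (unit x)
              V = v x
              W = w x ^ suc m
              u = (w x + τ) * V
              u≈1 : u ≈ 1#
              u≈1 = *-recip (w+τ≉0 x≉0)
              δ≈1 : δ x ≈ 1#
              δ≈1 = unit-φ x≉0
              δδ≈1 : δ x * δ x ≈ 1#
              δδ≈1 = trans (*-cong δ≈1 δ≈1) (*-identityˡ 1#)
              W≈ : W ≈ z * z
              W≈ = *-cancelˡ-≉0 (*-≉0 (unit-≉0 x≉0) (unit-≉0 x≉0)) (trans (w^n≈1 x≉0) (sym (trans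
                (solve 2 (λ y z → y :* y :* (z :* z) := y :* z :* (y :* z)) refl y z) δδ≈1)))
              G≈ : (z + τ * y) * V ≈ unit (f x)
              G≈ = trans (*-congʳ (sym (unit-f x≉0))) (trans
                (solve 3 (λ s g V → s :* g :* V := s :* V :* g) refl (w x + τ) (unit (f x)) V)
                (trans (*-congʳ u≈1) (*-identityˡ _)))

        τ²≉1⇒equation : ¬ (τ * τ ≈ 1#) → let Y = (- τ) ^ suc (suc m) in
          (τ * τ + 1#) * (1# - Y) + (τ * τ - 1#) * (Y + suc m · 1#) ≈ 0#
        τ²≉1⇒equation τ²≉1 = trans
          (solve 3 (λ t Y k → (t :* t :+ con (+ 1)) :* (con (+ 1) :- Y) :+ (t :* t :- con (+ 1)) :* (Y :+ k) :=
            (:- t :* :- t :+ con (+ 1)) :* (con (+ 1) :- Y) :+ (:- t :* :- t :- con (+ 1)) :* (Y :+ k)) refl τ _ _)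
          -- `A` and `B` share the factor τ² - 1, which is cancelled; what remains is the relation
          -- for X = -τ.
          (X^n-equation -τ≉0 Σδ≉0 (*-cancel-≉0 (τ²≉1 ∘ x-y≈0⇒x≈y) (begin
            (τ * τ - 1#) * ((- τ * - τ + 1#) * T 0 + - τ * (- τ * - τ - 1#) * U 0)
              ≈⟨ solve 3 (λ t T U → let one = con (+ 1) in
                   (t :* t :- one) :* ((:- t :* :- t :+ one) :* T :+ :- t :* (:- t :* :- t :- one) :* U) :=
                   con (+ 0) :+ (t :* t :+ one) :* (t :* t :- one) :* T :+ :- (t :* ((t :* t :- one) :* (t :* t :- one))) :* U)
                   refl τ (T 0) (U 0) ⟩
            0# + A * T 0 + B * U 0
              ≈⟨ +-cong (+-cong (Σδw^a≈0 m ℕₚ.≤-refl) (Σ-* A (λ x → δ x * 1# * v x))) (Σ-* B (λ x → δ x * 1# * (v x * v x))) ⟨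
            Σ (λ x → δ x * w x ^ suc m) + Σ (λ x → A * (δ x * 1# * v x)) + Σ (λ x → B * (δ x * 1# * (v x * v x)))
              ≈⟨ trans (Σ-+ (λ x → δ x * w x ^ suc m + A * (δ x * 1# * v x)) (λ x → B * (δ x * 1# * (v x * v x))))
                   (+-congʳ (Σ-+ (λ x → δ x * w x ^ suc m) (λ x → A * (δ x * 1# * v x)))) ⟨
            Σ (λ x → δ x * w x ^ suc m + A * (δ x * 1# * v x) + B * (δ x * 1# * (v x * v x)))
              ≈⟨ Σ-cong partial-fractions ⟨
            Σ (λ x → τ * τ * (unit (f x) * unit (f x)))
              ≈⟨ Σ-* (τ * τ) (λ x → unit (f x) * unit (f x)) ⟩
            τ * τ * Σ (λ x → unit (f x) * unit (f x))
              ≈⟨ trans (*-congˡ Σ-unit[f]²≈0) (zeroʳ _) ⟩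
            0# ∎)))

      -- In characteristic 2 an element with square 1 is 1, so w has nontrivial powers below n = q +
      -- 1 just as y has. Since n reduces to 1 and 2 to 0, the equation collapses to τ² = 1; but
      -- then -τ = 1, and Y = 1 is excluded.
      even-impossible : ¬ (2 · 1# ≈ 0#)
      even-impossible 2≈0 = go (τ * τ ≟ 1#)
        where
        square≈1⇒≈1 : ∀ {x} → x * x ≈ 1# → x ≈ 1#
        square≈1⇒≈1 {x} x²≈1 = x-y≈0⇒x≈y (^≈0⇒≈0 2 (begin
          (x - 1#) * ((x - 1#) * 1#)        ≈⟨ solve 1 (λ x → (x :- con (+ 1)) :* ((x :- con (+ 1)) :* con (+ 1)) :=
                                                 x :* x :- con (+ 1) :- con (+ 2) :* (x :- con (+ 1))) refl x ⟩
          x * x - 1# - 2 · 1# * (x - 1#)    ≈⟨ +-cong (x≈y⇒x-y≈0 x²≈1) (-‿cong (trans (*-congʳ 2≈0) (zeroˡ _))) ⟩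
          0# - 0#                           ≈⟨ -‿inverseʳ 0# ⟩
          0#                                ∎))

        w^n≈1 : ∀ {x} → ¬ (x ≈ 0#) → w x ^ suc q ≈ 1#
        w^n≈1 {x} x≉0 = trans (^-distrib-* (unit x) (unit x) (suc q))
          (trans (*-cong (unit-φ x≉0) (unit-φ x≉0)) (*-identityˡ 1#))

        ∃-w^a≉1 : ∀ a → a ℕ.≤ e → ∃[ b ] ¬ (b ≈ 0#) × ¬ (w b ^ suc a ≈ 1#)
        ∃-w^a≉1 a a≤e =
          let b , b≉0 , b^d≉1 = ∃-x^d≉1 (a ℕ.+ suc r ℕ.* suc a) (1+[1+e]*≤⇒< r (suc a) (s≤s a≤e))
          in b , b≉0 , λ w^a≈1 → b^d≉1 (trans (sym (^-assocʳ b e (suc a)))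
               (square≈1⇒≈1 (trans (sym (^-distrib-* (unit b) (unit b) (suc a))) w^a≈1)))

        go : Dec (τ * τ ≈ 1#) → ⊥
        go (yes τ²≈1) = [-τ]^n≉1 e w^n≈1 ∃-w^a≉1
          (trans (^-congˡ (suc q) (square≈1⇒≈1 (trans (solve 1 (λ t → :- t :* :- t := t :* t) refl τ) τ²≈1)))
                 (1^n≈1 (suc q)))
        go (no  τ²≉1) = τ²≉1 (x-y≈0⇒x≈y (begin
          τ * τ - 1#
            ≈⟨ solve 3 (λ t Y k → let one = con (+ 1) in
                 t :* t :- one := ((t :* t :+ one) :* (one :- Y) :+ (t :* t :- one) :* (Y :+ k))
                   :- (k :* (t :* t :- one) :+ con (+ 2) :* (one :- Y))) refl τ Y (q · 1#) ⟩
          (τ * τ + 1#) * (1# - Y) + (τ * τ - 1#) * (Y + q · 1#) - (q · 1# * (τ * τ - 1#) + 2 · 1# * (1# - Y))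
            ≈⟨ +-cong (τ²≉1⇒equation e w^n≈1 ∃-w^a≉1 τ²≉1)
                 (-‿cong (+-cong (trans (*-congʳ q·1≈0) (zeroˡ _)) (trans (*-congʳ 2≈0) (zeroˡ _)))) ⟩
          0# - (0# + 0#)  ≈⟨ solve 0 (con (+ 0) :- (con (+ 0) :+ con (+ 0)) := con (+ 0)) refl ⟩
          0#              ∎))
          where Y = (- τ) ^ suc q

    w^n≈1 : ∀ h → q ≡ 1 ℕ.+ 2 ℕ.* h → ∀ {x} → ¬ (x ≈ 0#) → w x ^ suc h ≈ 1#
    w^n≈1 h q≡ {x} x≉0 = begin
      w x * w x ^ h            ≈⟨ *-assoc _ _ _ ⟩
      unit x * (unit x * w x ^ h)  ≈⟨ *-congˡ (φ≈*[x²]^h h q≡ (unit x)) ⟨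
      unit x * φ (unit x)      ≈⟨ unit-φ x≉0 ⟩
      1#                       ∎

    τ-value : Bijective _≈_ _≈_ f → ∀ h → q ≡ 1 ℕ.+ 2 ℕ.* h →
      (τ ≈ 1# × ¬ ((- 1#) ^ suc h ≈ 1#)) ⊎ (τ ≈ -3# × (3 · 1#) ^ h ≈ 1#) ⊎ (τ ≈ 3 · 1# × -3# ^ h ≈ - 1#)
    τ-value f-bijective h@(suc m) q≡ = go (τ * τ ≟ 1#)
      where
      open PowerSums f-bijective

      e≡2h : e ≡ 2 ℕ.* h
      e≡2h = ℕₚ.suc-injective q≡

      ∃-w^a≉1 : ∀ a → a ℕ.≤ m → ∃[ b ] ¬ (b ≈ 0#) × ¬ (w b ^ suc a ≈ 1#)
      ∃-w^a≉1 a a≤m =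
        let b , b≉0 , b^d≉1 = ∃-x^d≉1 _ (1+[1+e]*≤⇒< r (2 ℕ.* suc a)
              (ℕₚ.m≤n⇒m≤1+n (≡.subst (2 ℕ.* suc a ℕ.≤_) (≡.sym e≡2h) (ℕₚ.*-monoʳ-≤ 2 (s≤s a≤m)))))
        in b , b≉0 , λ w^a≈1 → b^d≉1 (begin
             b ^ (e ℕ.* (2 ℕ.* suc a))   ≈⟨ ^-assocʳ b e (2 ℕ.* suc a) ⟨
             unit b ^ (2 ℕ.* suc a)      ≈⟨ ^-assocʳ (unit b) 2 (suc a) ⟨
             (unit b ^ 2) ^ suc a        ≈⟨ ^-congˡ (suc a) (*-congˡ (*-identityʳ (unit b))) ⟩
             w b ^ suc a                 ≈⟨ w^a≈1 ⟩
             1#                          ∎)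

      Y Y₁ : Carrier
      Y = (- τ) ^ suc h
      Y₁ = (- τ) ^ h

      Y≉1 : ¬ (Y ≈ 1#)
      Y≉1 = [-τ]^n≉1 m (w^n≈1 h q≡) ∃-w^a≉1

      2*h·1≈-1 : 1# + 2 · 1# * h · 1# ≈ 0#
      2*h·1≈-1 = trans (+-congˡ (sym (×1-homo-* 2 h))) (trans (×-congˡ (≡.sym q≡)) q·1≈0)

      τ≈±1 : τ * τ ≈ 1# → τ ≈ 1# ⊎ - τ ≈ 1#
      τ≈±1 τ²≈1 = ⊎-map x-y≈0⇒x≈y x-y≈0⇒x≈y (*≈0⇒≈0 (trans (solve 1 (λ t → (t :- con (+ 1)) :* (:- t :- con (+ 1)) := :- (t :* t :- con (+ 1))) refl τ)
                                       (trans (-‿cong (x≈y⇒x-y≈0 τ²≈1)) -0#≈0#)))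

      module _ (τ²≉1 : ¬ (τ * τ ≈ 1#)) where

        4Y≈τ²+3 : 4 · 1# * Y ≈ τ * τ + 3 · 1#
        4Y≈τ²+3 = sym (x-y≈0⇒x≈y (begin
          τ * τ + 3 · 1# - 4 · 1# * Y
            ≈⟨ solve 3 (λ t Y k → let one = con (+ 1) in
                 t :* t :+ con (+ 3) :- con (+ 4) :* Y :=
                 con (+ 2) :* ((t :* t :+ one) :* (one :- Y) :+ (t :* t :- one) :* (Y :+ k))
                   :- (one :+ con (+ 2) :* k) :* (t :* t :- one)) refl τ Y (h · 1#) ⟩
          2 · 1# * ((τ * τ + 1#) * (1# - Y) + (τ * τ - 1#) * (Y + h · 1#)) - (1# + 2 · 1# * h · 1#) * (τ * τ - 1#)
            ≈⟨ +-cong (*-congˡ (τ²≉1⇒equation m (w^n≈1 h q≡) ∃-w^a≉1 τ²≉1)) (-‿cong (*-congʳ 2*h·1≈-1)) ⟩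
          2 · 1# * 0# - 0# * (τ * τ - 1#)
            ≈⟨ solve 1 (λ t → con (+ 2) :* con (+ 0) :- con (+ 0) :* (t :* t :- con (+ 1)) := con (+ 0)) refl τ ⟩
          0# ∎))

        -- As 2(h + 1) = q + 1, the square of Y is -τ times its conjugate, and φ fixes τ.
        Y²≈τ² : Y * Y ≈ τ * τ
        Y²≈τ² = begin
          Y * Y                          ≈⟨ ^-distrib-* (- τ) (- τ) (suc h) ⟨
          - τ * - τ * (- τ * - τ) ^ h    ≈⟨ *-assoc _ _ _ ⟩
          - τ * (- τ * (- τ * - τ) ^ h)  ≈⟨ *-congˡ (φ≈*[x²]^h h q≡ (- τ)) ⟨
          - τ * φ (- τ)                  ≈⟨ *-congˡ (trans (φ-neg τ) (-‿cong φτ≈τ)) ⟩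
          - τ * - τ                      ≈⟨ solve 1 (λ t → :- t :* :- t := t :* t) refl τ ⟩
          τ * τ                          ∎

        -- Squaring 4Y = τ² + 3 gives (τ² + 3)² = 16 τ², and (τ² + 3)² - 16 τ² = (τ² - 1)(τ² - 9).
        [τ-3][τ+3]≈0 : (τ - 3 · 1#) * (τ - -3#) ≈ 0#
        [τ-3][τ+3]≈0 = *-cancel-≉0 (τ²≉1 ∘ x-y≈0⇒x≈y) (begin
          (τ * τ - 1#) * ((τ - 3 · 1#) * (τ - -3#))
            ≈⟨ solve 2 (λ t Y →
                 (t :* t :- con (+ 1)) :* ((t :- con (+ 3)) :* (t :- con -[1+ 2 ])) :=
                 (t :* t :+ con (+ 3) :- con (+ 4) :* Y) :* (t :* t :+ con (+ 3) :+ con (+ 4) :* Y)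
                   :+ con (+ 16) :* (Y :* Y :- t :* t)) refl τ Y ⟩
          (τ * τ + 3 · 1# - 4 · 1# * Y) * (τ * τ + 3 · 1# + 4 · 1# * Y) + 16 · 1# * (Y * Y - τ * τ)
            ≈⟨ +-cong (*-congʳ (x≈y⇒x-y≈0 (sym 4Y≈τ²+3))) (*-congˡ (x≈y⇒x-y≈0 Y²≈τ²)) ⟩
          0# * (τ * τ + 3 · 1# + 4 · 1# * Y) + 16 · 1# * 0#
            ≈⟨ trans (+-cong (zeroˡ _) (zeroʳ _)) (+-identityˡ 0#) ⟩
          0# ∎)

        Y≈3 : τ * τ ≈ 3 · 1# * 3 · 1# → Y ≈ 3 · 1#
        Y≈3 τ²≈9 = *-cancelˡ-≉0 (*-≉0 (2≉0 h q≡) (2≉0 h q≡)) (begin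
          2 · 1# * 2 · 1# * Y        ≈⟨ solve 1 (λ Y → con (+ 2) :* con (+ 2) :* Y := con (+ 4) :* Y) refl Y ⟩
          4 · 1# * Y                 ≈⟨ trans 4Y≈τ²+3 (+-congʳ τ²≈9) ⟩
          3 · 1# * 3 · 1# + 3 · 1#   ≈⟨ solve 0 (con (+ 3) :* con (+ 3) :+ con (+ 3) := con (+ 2) :* con (+ 2) :* con (+ 3)) refl ⟩
          2 · 1# * 2 · 1# * 3 · 1#   ∎)

        -- Y is -τ times the h-th power of -τ, so cancelling -τ from Y = 3 gives that power: -1
        -- here, and 1 for τ = -3.
        case-3 : τ ≈ 3 · 1# → τ ≈ 3 · 1# × -3# ^ h ≈ - 1#
        case-3 τ≈3 = (τ≈3 , trans (^-congˡ h (-‿cong (sym τ≈3)))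
          (*-cancelˡ-≉0 (τ≉0 ∘ trans (sym (-‿involutive τ)) ∘ λ eq → trans (-‿cong eq) -0#≈0#) (begin
            - τ * Y₁      ≈⟨ Y≈3 (*-cong τ≈3 τ≈3) ⟩
            3 · 1#        ≈⟨ τ≈3 ⟨
            τ             ≈⟨ solve 1 (λ t → t := :- t :* :- con (+ 1)) refl τ ⟩
            - τ * - 1#    ∎)))

        case-[-3] : τ ≈ -3# → τ ≈ -3# × (3 · 1#) ^ h ≈ 1#
        case-[-3] τ≈-3 = (τ≈-3 , trans (^-congˡ h (sym -τ≈3))
          (*-cancelˡ-≉0 (τ≉0 ∘ trans (sym (-‿involutive τ)) ∘ λ eq → trans (-‿cong eq) -0#≈0#) (begin
            - τ * Y₁      ≈⟨ Y≈3 (trans (*-cong τ≈-3 τ≈-3) (solve 0 (con -[1+ 2 ] :* con -[1+ 2 ] := con (+ 3) :* con (+ 3)) refl)) ⟩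
            3 · 1#        ≈⟨ -τ≈3 ⟨
            - τ           ≈⟨ *-identityʳ (- τ) ⟨
            - τ * 1#      ∎)))
          where
          -τ≈3 : - τ ≈ 3 · 1#
          -τ≈3 = trans (-‿cong τ≈-3) (-‿involutive _)

        τ≈±3 : (τ ≈ -3# × (3 · 1#) ^ h ≈ 1#) ⊎ (τ ≈ 3 · 1# × -3# ^ h ≈ - 1#)
        τ≈±3 = [ inj₂ ∘ case-3 ∘ x-y≈0⇒x≈y , inj₁ ∘ case-[-3] ∘ x-y≈0⇒x≈y ]′ (*≈0⇒≈0 [τ-3][τ+3]≈0)

      go : Dec (τ * τ ≈ 1#) → (τ ≈ 1# × ¬ ((- 1#) ^ suc h ≈ 1#)) ⊎ (τ ≈ -3# × (3 · 1#) ^ h ≈ 1#) ⊎ (τ ≈ 3 · 1# × -3# ^ h ≈ - 1#)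
      go (no  τ²≉1) = inj₂ (τ≈±3 τ²≉1)
      go (yes τ²≈1) = [ (λ τ≈1  → inj₁ (τ≈1 , Y≉1 ∘ trans (^-congˡ (suc h) (-‿cong τ≈1))))
                      , (λ -τ≈1 → contradiction (trans (^-congˡ (suc h) -τ≈1) (1^n≈1 (suc h))) Y≉1)
                      ]′ (τ≈±1 τ²≈1)

    -- Sufficiency: injectivity through the polynomial E

    E : Carrier → Carrier → Carrier → Carrier
    E t a b = t * (a * a * (b * b) + 1#) + (1# - t * t) * (a * b) + (a * a + b * b)

    E-cong : ∀ {t t′ a b} → t ≈ t′ → E t a b ≈ E t′ a b
    E-cong t≈t′ = +-congʳ (+-cong (*-congʳ t≈t′) (*-congʳ (+-congˡ (-‿cong (*-cong t≈t′ t≈t′)))))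

    bijective-criterion : (∀ {x} → ¬ (x ≈ 0#) → ¬ (w x + τ ≈ 0#)) →
      (∀ {x z} → ¬ (x ≈ 0#) → ¬ (z ≈ 0#) → E τ (unit x) (unit z) ≈ 0# → unit x ≈ unit z) →
      Bijective _≈_ _≈_ f
    bijective-criterion w+τ≉0 E≈0⇒≈ = injective⇒bijective f-cong (λ {x} {z} → f-injective x z (x ≟ 0#) (z ≟ 0#))
      where
      f≉0 : ∀ {x} → ¬ (x ≈ 0#) → ¬ (f x ≈ 0#)
      f≉0 {x} x≉0 fx≈0 = w+τ≉0 x≉0 (trans (w+τ≈ x≉0) (trans (*-congˡ (trans (*-congˡ fx≈0) (zeroʳ x))) (zeroʳ _)))

      unit-f-cubic : ∀ {x} → ¬ (x ≈ 0#) → let a = unit x in a * (a * a + τ) * unit (f x) ≈ 1# + τ * (a * a)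
      unit-f-cubic {x} x≉0 = trans (*-assoc _ _ _) (trans (*-congˡ (unit-f x≉0)) (trans
        (solve 3 (λ a ā t → a :* (ā :+ t :* a) := a :* ā :+ t :* (a :* a)) refl (unit x) (φ (unit x)) τ)
        (+-congʳ (unit-φ x≉0))))

      unit-injective : ∀ {x z} → ¬ (x ≈ 0#) → ¬ (z ≈ 0#) → f x ≈ f z → unit x ≈ unit z
      unit-injective {x} {z} x≉0 z≉0 fx≈fz =
        [ sym ∘ x-y≈0⇒x≈y , E≈0⇒≈ x≉0 z≉0 ]′ (*≈0⇒≈0 (begin
          (b - a) * E τ a b
            -- `E` arises as the cofactor of b - a when the equality of the images of a and b is
            -- cross-multiplied.
            ≈⟨ solve 3 (λ a b t → let one = con (+ 1) in
                 (b :- a) :* (t :* (a :* a :* (b :* b) :+ one) :+ (one :- t :* t) :* (a :* b) :+ (a :* a :+ b :* b)) :=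
                 b :* (b :* b :+ t) :* (one :+ t :* (a :* a)) :- a :* (a :* a :+ t) :* (one :+ t :* (b :* b))) refl a b τ ⟩
          b * (b * b + τ) * (1# + τ * (a * a)) - a * (a * a + τ) * (1# + τ * (b * b))
            ≈⟨ +-cong (*-congˡ (unit-f-cubic x≉0)) (-‿cong (*-congˡ (trans (*-congˡ (unit-cong fx≈fz)) (unit-f-cubic z≉0)))) ⟨
          b * (b * b + τ) * (a * (a * a + τ) * unit (f x)) - a * (a * a + τ) * (b * (b * b + τ) * unit (f x))
            ≈⟨ solve 3 (λ u v g → u :* (v :* g) :- v :* (u :* g) := con (+ 0)) refl _ _ _ ⟩
          0# ∎))
        where
        a = unit x
        b = unit z

      f-injective : ∀ x z → Dec (x ≈ 0#) → Dec (z ≈ 0#) → f x ≈ f z → x ≈ z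
      f-injective x z (yes x≈0) (yes z≈0) fx≈fz = trans x≈0 (sym z≈0)
      f-injective x z (yes x≈0) (no  z≉0) fx≈fz = contradiction (trans (sym fx≈fz) (trans (f-cong x≈0) f0≈0)) (f≉0 z≉0)
      f-injective x z (no  x≉0) (yes z≈0) fx≈fz = contradiction (trans fx≈fz (trans (f-cong z≈0) f0≈0)) (f≉0 x≉0)
      -- Since x f(x) depends on `unit x` only, equal units give x f(x) = z f(z), and the common
      -- value of f cancels.
      f-injective x z (no  x≉0) (no  z≉0) fx≈fz = *-cancelˡ-≉0 (f≉0 x≉0) (begin
        f x * x                       ≈⟨ *-comm _ _ ⟩
        x * f x                       ≈⟨ x*f≈ x ⟩
        unit x + τ * φ (unit x)       ≈⟨ +-cong a≈b (*-congˡ (φ-cong a≈b)) ⟩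
        unit z + τ * φ (unit z)       ≈⟨ x*f≈ z ⟨
        z * f z                       ≈⟨ *-congˡ fx≈fz ⟨
        z * f x                       ≈⟨ *-comm _ _ ⟩
        f x * z                       ∎)
        where a≈b = unit-injective x≉0 z≉0 fx≈fz

    τ≈1⇒bijective : ∀ h → q ≡ 1 ℕ.+ 2 ℕ.* h → (- 1#) ^ h ≈ 1# → τ ≈ 1# → Bijective _≈_ _≈_ f
    τ≈1⇒bijective h q≡ [-1]^h≈1 τ≈1 = bijective-criterion w+τ≉0 λ x≉0 z≉0 E≈0 → contradiction
      (trans (solve 2 (λ a b → let one = con (+ 1) in (a :* a :+ one) :* (b :* b :+ one) :=
                one :* (a :* a :* (b :* b) :+ one) :+ (one :- one :* one) :* (a :* b) :+ (a :* a :+ b :* b)) refl _ _)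
        (trans (E-cong (sym τ≈1)) E≈0))
      (*-≉0 (w+τ≉0 x≉0 ∘ trans (+-congˡ τ≈1)) (w+τ≉0 z≉0 ∘ trans (+-congˡ τ≈1)))
      where
      -- If w were -1, its power h + 1 would be -(-1)^h = -1 and not 1.
      w+τ≉0 : ∀ {x} → ¬ (x ≈ 0#) → ¬ (w x + τ ≈ 0#)
      w+τ≉0 {x} x≉0 w+τ≈0 = 2≉0 h q≡ (begin
        2 · 1#                       ≈⟨ solve 0 (con (+ 2) := con (+ 1) :+ con (+ 1)) refl ⟩
        1# + 1#                      ≈⟨ +-congʳ (w^n≈1 h q≡ x≉0) ⟨
        w x ^ suc h + 1#             ≈⟨ +-congʳ (^-congˡ (suc h) w≈-1) ⟩
        - 1# * (- 1#) ^ h + 1#       ≈⟨ +-congʳ (trans (*-congˡ [-1]^h≈1) (*-identityʳ _)) ⟩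
        - 1# + 1#                    ≈⟨ -‿inverseˡ 1# ⟩
        0#                           ∎)
        where
        w≈-1 : w x ≈ - 1#
        w≈-1 = x-y≈0⇒x≈y (trans (+-congˡ (trans (-‿involutive 1#) (sym τ≈1))) w+τ≈0)

    -- A zero of w + τ gives y + τ φ(y) = 0 and, by conjugation, φ(y) + τ y = 0; eliminating φ(y)
    -- leaves y (1 - τ²) = 0.
    τ²≉1⇒w+τ≉0 : ¬ (τ * τ ≈ 1#) → ∀ {x} → ¬ (x ≈ 0#) → ¬ (w x + τ ≈ 0#)
    τ²≉1⇒w+τ≉0 τ²≉1 {x} x≉0 w+τ≈0 = τ²≉1 (sym (x-y≈0⇒x≈y (*-cancel-≉0 (unit-≉0 x≉0) (begin
      y * (1# - τ * τ)                       ≈⟨ solve 3 (λ y ȳ t → y :* (con (+ 1) :- t :* t) := y :+ t :* ȳ :- t :* (ȳ :+ t :* y)) refl y (φ y) τ ⟩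
      y + τ * φ y - τ * (φ y + τ * y)        ≈⟨ +-cong s≈0 (-‿cong (*-congˡ (trans (sym (φ[y+τφy]≈ y)) (trans (φ-cong s≈0) (0^[1+n]≈0 e))))) ⟩
      0# - τ * 0#                            ≈⟨ solve 1 (λ t → con (+ 0) :- t :* con (+ 0) := con (+ 0)) refl τ ⟩
      0#                                     ∎))))
      where
      y = unit x
      s≈0 : y + τ * φ y ≈ 0#
      s≈0 = trans (sym (x*f≈ x)) (*-cancel-≉0 (unit-≉0 x≉0) (trans (sym (w+τ≈ x≉0)) w+τ≈0))

    -- From A² = κB² one gets (A^q)B = κ^h(B^q)A; here A^q and B^q are multiples of A and B.
    twisted-square : ∀ h → q ≡ 1 ℕ.+ 2 ℕ.* h → ∀ {κ σ s A B} → κ ^ h ≈ σ →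
      s * φ A ≈ - A → σ * (s * φ B) ≈ B → A * A ≈ κ * (B * B) → A ≈ 0#
    twisted-square h q≡ {κ} {σ} {s} {A} {B} κ^h≈σ sφA σsφB A²≈κB² = go (*≈0⇒≈0 AB≈0)
      where
      AB≈0 : A * B ≈ 0#
      AB≈0 = *-cancel-≉0 (2≉0 h q≡) (begin
        2 · 1# * (A * B)                             ≈⟨ solve 2 (λ A B → con (+ 2) :* (A :* B) := A :* B :- :- A :* B) refl A B ⟩
        A * B - - A * B                              ≈⟨ +-cong (*-congˡ σsφB) (-‿cong (*-congʳ sφA)) ⟨
        A * (σ * (s * φ B)) - s * φ A * B            ≈⟨ +-cong (*-congˡ (*-cong (sym κ^h≈σ) (*-congˡ (φ≈*[x²]^h h q≡ B))))
                                                         (-‿cong (*-congʳ (*-congˡ (trans (φ≈*[x²]^h h q≡ A)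
                                                           (*-congˡ (trans (^-congˡ h A²≈κB²) (^-distrib-* κ (B * B) h))))))) ⟩
        A * (κ ^ h * (s * (B * (B * B) ^ h))) - s * (A * (κ ^ h * (B * B) ^ h)) * B
          ≈⟨ solve 5 (λ A B s k b → A :* (k :* (s :* (B :* b))) :- s :* (A :* (k :* b)) :* B := con (+ 0)) refl A B s (κ ^ h) _ ⟩
        0#                                           ∎)
      go : A ≈ 0# ⊎ B ≈ 0# → A ≈ 0#
      go (inj₁ A≈0) = A≈0
      go (inj₂ B≈0) = ^≈0⇒≈0 2 (trans (*-congˡ (*-identityʳ A)) (trans A²≈κB²
        (trans (*-congˡ (trans (*-congʳ B≈0) (zeroˡ B))) (zeroʳ κ))))

    module _ (h : ℕ) (q≡ : q ≡ 1 ℕ.+ 2 ℕ.* h) where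

      private
        9≉1 : ¬ (3 · 1# * 3 · 1# ≈ 1#)
        9≉1 9≈1 = *-≉0 (2≉0 h q≡) (*-≉0 (2≉0 h q≡) (2≉0 h q≡)) (trans
          (solve 0 (con (+ 2) :* (con (+ 2) :* con (+ 2)) := con (+ 3) :* con (+ 3) :- con (+ 1)) refl) (x≈y⇒x-y≈0 9≈1))

        module _ {x z} (x≉0 : ¬ (x ≈ 0#)) (z≉0 : ¬ (z ≈ 0#)) where
          a = unit x
          b = unit z

          φ[ab]≈ : a * b * φ (a * b) ≈ 1#
          φ[ab]≈ = trans (*-congˡ (φ-* a b)) (trans
            (solve 4 (λ a b ā b̄ → a :* b :* (ā :* b̄) := a :* ā :* (b :* b̄)) refl a b (φ a) (φ b))
            (trans (*-cong (unit-φ x≉0) (unit-φ z≉0)) (*-identityˡ 1#)))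

          -- As φ inverts a and b, the factor ab clears the denominators of the conjugates. It is
          -- the common s of `twisted-square`, with σ = -1 for ab - 1 and σ = 1 for ab + 1.
          φ[a-b]≈ : a * b * φ (a - b) ≈ - (a - b)
          φ[a-b]≈ = begin
            a * b * φ (a - b)                  ≈⟨ *-congˡ (φ-sub a b) ⟩
            a * b * (φ a - φ b)                ≈⟨ solve 4 (λ a b ā b̄ → a :* b :* (ā :- b̄) := b :* (a :* ā) :- a :* (b :* b̄)) refl a b (φ a) (φ b) ⟩
            b * (a * φ a) - a * (b * φ b)      ≈⟨ +-cong (*-congˡ (unit-φ x≉0)) (-‿cong (*-congˡ (unit-φ z≉0))) ⟩
            b * 1# - a * 1#                    ≈⟨ solve 2 (λ a b → b :* con (+ 1) :- a :* con (+ 1) := :- (a :- b)) refl a b ⟩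
            - (a - b)                          ∎

          φ[ab-1]≈ : - 1# * (a * b * φ (a * b - 1#)) ≈ a * b - 1#
          φ[ab-1]≈ = begin
            - 1# * (a * b * φ (a * b - 1#))         ≈⟨ *-congˡ (*-congˡ (trans (φ-sub _ _) (+-congˡ (-‿cong φ-1)))) ⟩
            - 1# * (a * b * (φ (a * b) - 1#))       ≈⟨ solve 2 (λ s t → :- con (+ 1) :* (s :* (t :- con (+ 1))) := s :- s :* t) refl (a * b) _ ⟩
            a * b - a * b * φ (a * b)               ≈⟨ +-congˡ (-‿cong φ[ab]≈) ⟩
            a * b - 1#                              ∎

          φ[ab+1]≈ : 1# * (a * b * φ (a * b + 1#)) ≈ a * b + 1#
          φ[ab+1]≈ = begin
            1# * (a * b * φ (a * b + 1#))         ≈⟨ *-congˡ (*-congˡ (trans (φ-+ _ _) (+-congˡ φ-1))) ⟩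
            1# * (a * b * (φ (a * b) + 1#))       ≈⟨ solve 2 (λ s t → con (+ 1) :* (s :* (t :+ con (+ 1))) := s :+ s :* t) refl (a * b) _ ⟩
            a * b + a * b * φ (a * b)             ≈⟨ +-congˡ φ[ab]≈ ⟩
            a * b + 1#                            ∎

      τ≈3⇒bijective : -3# ^ h ≈ - 1# → τ ≈ 3 · 1# → Bijective _≈_ _≈_ f
      τ≈3⇒bijective [-3]^h≈-1 τ≈3 = bijective-criterion
        (τ²≉1⇒w+τ≉0 (9≉1 ∘ trans (*-cong (sym τ≈3) (sym τ≈3))))
        λ {x} {z} x≉0 z≉0 E≈0 → x-y≈0⇒x≈y (twisted-square h q≡ [-3]^h≈-1 (φ[a-b]≈ x≉0 z≉0) (φ[ab-1]≈ x≉0 z≉0)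
          (x-y≈0⇒x≈y (trans
            (solve 2 (λ a b → let one = con (+ 1); t = con (+ 3); s = a :* b :- one in
               (a :- b) :* (a :- b) :- con -[1+ 2 ] :* (s :* s) :=
               t :* (a :* a :* (b :* b) :+ one) :+ (one :- t :* t) :* (a :* b) :+ (a :* a :+ b :* b)) refl (unit x) (unit z))
            (trans (E-cong (sym τ≈3)) E≈0))))

      τ≈-3⇒bijective : (3 · 1#) ^ h ≈ 1# → τ ≈ -3# → Bijective _≈_ _≈_ f
      τ≈-3⇒bijective 3^h≈1 τ≈-3 = bijective-criterion
        (τ²≉1⇒w+τ≉0 (9≉1 ∘ trans (trans (solve 0 (con (+ 3) :* con (+ 3) := con -[1+ 2 ] :* con -[1+ 2 ]) refl) (*-cong (sym τ≈-3) (sym τ≈-3)))))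
        λ {x} {z} x≉0 z≉0 E≈0 → x-y≈0⇒x≈y (twisted-square h q≡ 3^h≈1 (φ[a-b]≈ x≉0 z≉0) (φ[ab+1]≈ x≉0 z≉0)
          (x-y≈0⇒x≈y (trans
            (solve 2 (λ a b → let one = con (+ 1); t = con -[1+ 2 ]; s = a :* b :+ one in
               (a :- b) :* (a :- b) :- con (+ 3) :* (s :* s) :=
               t :* (a :* a :* (b :* b) :+ one) :+ (one :- t :* t) :* (a :* b) :+ (a :* a :+ b :* b)) refl (unit x) (unit z))
            (trans (E-cong (sym τ≈-3)) E≈0))))

-- Prime divisors and residues of q

prime∣prime^⇒≡ : ∀ {r p} → Prime r → Prime p → ∀ k → r ∣ p ℕ.^ k → r ≡ p
prime∣prime^⇒≡ {r} r-prime p-prime zero r∣1 = contradiction (∣1⇒≡1 r∣1)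
  (ℕₚ.<⇒≢ (ℕ.nonTrivial⇒n>1 r {{prime⇒nonTrivial r-prime}}) ∘ ≡.sym)
prime∣prime^⇒≡ {r} {p} r-prime p-prime (suc k) r∣ with euclidsLemma p (p ℕ.^ k) r-prime r∣
... | inj₂ r∣p^k = prime∣prime^⇒≡ r-prime p-prime k r∣p^k
... | inj₁ r∣p   with prime⇒irreducible p-prime r∣p
...   | inj₁ r≡1 = contradiction (≡.sym r≡1) (ℕₚ.<⇒≢ (ℕ.nonTrivial⇒n>1 r {{prime⇒nonTrivial r-prime}}))
...   | inj₂ r≡p = r≡p

mod-2-cases : ∀ n → (∃[ h ] n ≡ 2 ℕ.* h) ⊎ (∃[ h ] n ≡ 1 ℕ.+ 2 ℕ.* h)
mod-2-cases n with n ℕᵈ.divMod 2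
... | ℕᵈ.result h zero       eq = inj₁ (h , ≡.trans eq (ℕₚ.*-comm h 2))
... | ℕᵈ.result h (suc zero) eq = inj₂ (h , ≡.trans eq (≡.cong suc (ℕₚ.*-comm h 2)))

mod-3-cases : ∀ n → (∃[ j ] n ≡ 3 ℕ.* j) ⊎ (∃[ j ] n ≡ 1 ℕ.+ 3 ℕ.* j) ⊎ (∃[ j ] n ≡ 2 ℕ.+ 3 ℕ.* j)
mod-3-cases n with n ℕᵈ.divMod 3
... | ℕᵈ.result j zero             eq = inj₁ (j , ≡.trans eq (ℕₚ.*-comm j 3))
... | ℕᵈ.result j (suc zero)       eq = inj₂ (inj₁ (j , ≡.trans eq (≡.cong suc (ℕₚ.*-comm j 3))))
... | ℕᵈ.result j (suc (suc zero)) eq = inj₂ (inj₂ (j , ≡.trans eq (≡.cong (2 ℕ.+_) (ℕₚ.*-comm j 3))))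

-- From polynomials over F to maps of K

module EvalProperties (F : Field c₁ ℓ₁) (K : Field c₂ ℓ₂)
  (ι : Field.Carrier F → Field.Carrier K) (ι-embedding : IsFieldEmbedding F K ι) where

  private module F = FieldProperties F
  open FieldProperties K
  open RingMorphisms.IsRingMonomorphism ι-embedding public
    using () renaming (injective to ι-injective; ⟦⟧-cong to ι-cong; +-homo to ι-+; *-homo to ι-*
                      ; -‿homo to ι-neg; 0#-homo to ι-0; 1#-homo to ι-1)

  ι-^ : ∀ a n → ι (a F.^ n) ≈ ι a ^ n
  ι-^ a zero    = ι-1
  ι-^ a (suc n) = trans (ι-* a (a F.^ n)) (*-congˡ (ι-^ a n))

  ι-· : ∀ n → ι (n F.· F.1#) ≈ n · 1#
  ι-· zero    = ι-0
  ι-· (suc n) = trans (ι-+ F.1# (n F.· F.1#)) (+-cong ι-1 (ι-· n))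

  ι-fromℤ : ∀ i → ι (fromℤ F i) ≈ fromℤ K i
  ι-fromℤ (+ n)    = ι-· n
  ι-fromℤ -[1+ n ] = trans (ι-neg (suc n F.· F.1#)) (-‿cong (ι-· (suc n)))

  eval-cong : ∀ f {x y} → x ≈ y → eval K f x ≈ eval K f y
  eval-cong []      x≈y = refl
  eval-cong (a ∷ f) x≈y = +-congˡ (*-cong x≈y (eval-cong f x≈y))

  eval-monomial : ∀ a n x → eval K (map ι (monomial F a n)) x ≈ x ^ n * ι a
  eval-monomial a zero    x = trans (+-congˡ (zeroʳ x)) (trans (+-identityʳ _) (sym (*-identityˡ _)))
  eval-monomial a (suc n) x = trans (+-cong ι-0 (*-congˡ (eval-monomial a n x)))
    (trans (+-identityˡ _) (sym (*-assoc x _ _)))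

  eval-addPoly : ∀ f g x → eval K (map ι (addPoly F f g)) x ≈ eval K (map ι f) x + eval K (map ι g) x
  eval-addPoly []      g       x = sym (+-identityˡ _)
  eval-addPoly (a ∷ f) []      x = sym (+-identityʳ _)
  eval-addPoly (a ∷ f) (b ∷ g) x = trans (+-cong (ι-+ a b) (*-congˡ (eval-addPoly f g x)))
    (solve 5 (λ a b x u v → a :+ b :+ x :* (u :+ v) := a :+ x :* u :+ (b :+ x :* v)) refl (ι a) (ι b) x _ _)

-- Replaces the truncated subtractions by a polynomial in r = q - 3 that is visibly a successor.
exponent≡ : ∀ r → let q = 3 ℕ.+ r in q ℕ.^ 2 ℕ.∸ q ℕ.∸ 1 ≡ 5 ℕ.+ (5 ℕ.+ r) ℕ.* r
exponent≡ r = ≡.cong (ℕ._∸ 1) (≡.trans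
  (≡.cong (ℕ._∸ (3 ℕ.+ r)) (solve 1 (λ r → (con 3 :+ r) :* ((con 3 :+ r) :* con 1) := con 6 :+ (con 5 :+ r) :* r :+ (con 3 :+ r)) ≡.refl r))
  (ℕₚ.m+n∸n≡m (6 ℕ.+ (5 ℕ.+ r) ℕ.* r) (3 ℕ.+ r)))
  where open +-*-Solver

module Equivalence (r : ℕ) (p k : ℕ) (p-prime : Prime p) (q≡p^k : 3 ℕ.+ r ≡ p ℕ.^ k)
  (F : Field c₁ ℓ₁) (F-card : HasCardinality F (3 ℕ.+ r))
  (K : Field c₂ ℓ₂) (K-card : HasCardinality K ((3 ℕ.+ r) ℕ.^ 2))
  (ι : Field.Carrier F → Field.Carrier K) (ι-embedding : IsFieldEmbedding F K ι)
  (t : Field.Carrier F) (t≉0 : ¬ (Field._≈_ F t (Field.0# F))) where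

  private
    module F = Field F
    module S = +-*-Solver
  open EvalProperties F K ι ι-embedding
  open BinomialMaps K r K-card p k p-prime q≡p^k

  τ : Carrier
  τ = ι t

  f : Carrier → Carrier
  f = eval K (extendScalars F K ι (binomial F q t))

  τ≉0 : ¬ (τ ≈ 0#)
  τ≉0 τ≈0 = t≉0 (ι-injective (trans τ≈0 (sym ι-0)))

  φτ≈τ : φ τ ≈ τ
  φτ≈τ = trans (sym (ι-^ t q)) (ι-cong (FiniteField.x^cardinality≈x F q F-card t))

  f≈ : ∀ x → f x ≈ x ^ suc r + x ^ (5 ℕ.+ (5 ℕ.+ r) ℕ.* r) * τ
  f≈ x = begin
    f x                   ≈⟨ eval-addPoly (monomial F F.1# (suc r)) (monomial F t M) x ⟩
    eval K (map ι (monomial F F.1# (suc r))) x + eval K (map ι (monomial F t M)) x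
                          ≈⟨ +-cong (eval-monomial F.1# (suc r) x) (eval-monomial t M x) ⟩
    x ^ suc r * ι F.1# + x ^ M * τ
                          ≈⟨ +-cong (trans (*-congˡ ι-1) (*-identityʳ _)) (*-congʳ (^-congʳ x (exponent≡ r))) ⟩
    x ^ suc r + x ^ (5 ℕ.+ (5 ℕ.+ r) ℕ.* r) * τ  ∎
    where M = q ℕ.^ 2 ℕ.∸ q ℕ.∸ 1

  -- Both exponents are positive; for q - 2 this rests on q > 2.
  f0≈0 : f 0# ≈ 0#
  f0≈0 = trans (f≈ 0#) (trans (+-cong (0^[1+n]≈0 r) (trans (*-congʳ (0^[1+n]≈0 (4 ℕ.+ (5 ℕ.+ r) ℕ.* r))) (zeroˡ τ))) (+-identityˡ 0#))

  -- Multiplication by x raises the second exponent to q² - q = (q - 1) q.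
  x*f≈ : ∀ x → x * f x ≈ unit x + τ * φ (unit x)
  x*f≈ x = begin
    x * f x                               ≈⟨ *-congˡ (f≈ x) ⟩
    x * (x ^ suc r + x ^ (5 ℕ.+ (5 ℕ.+ r) ℕ.* r) * τ)
                                          ≈⟨ solve 4 (λ x u v t → x :* (u :+ v :* t) := x :* u :+ t :* (x :* v)) refl x _ _ τ ⟩
    unit x + τ * x ^ (6 ℕ.+ (5 ℕ.+ r) ℕ.* r)
                                          ≈⟨ +-congˡ (*-congˡ (trans (^-congʳ x (6+≡ r)) (sym (^-assocʳ x (suc (suc r)) q)))) ⟩
    unit x + τ * φ (unit x)               ∎
    where
    6+≡ : ∀ r → 6 ℕ.+ (5 ℕ.+ r) ℕ.* r ≡ suc (suc r) ℕ.* (3 ℕ.+ r)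
    6+≡ = S.solve 1 (λ r → S.con 6 S.:+ (S.con 5 S.:+ r) S.:* r S.:= (S.con 2 S.:+ r) S.:* (S.con 3 S.:+ r)) ≡.refl

  open BinomialMap τ τ≉0 φτ≈τ f
    (eval-cong (extendScalars F K ι (binomial F q t))) f0≈0 x*f≈

  prime-divisor·1≈0 : ∀ d → Prime d → d ∣ q → d · 1# ≈ 0#
  prime-divisor·1≈0 d d-prime d∣q =
    trans (×-congˡ (prime∣prime^⇒≡ d-prime p-prime k (≡.subst (d ∣_) q≡p^k d∣q))) char≈0

  t⇒τ : ∀ i → t F.≈ fromℤ F i → τ ≈ fromℤ K i
  t⇒τ i t≈ = trans (ι-cong t≈) (ι-fromℤ i)

  τ⇒t : ∀ i → τ ≈ fromℤ K i → t F.≈ fromℤ F i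
  τ⇒t i τ≈ = ι-injective (trans τ≈ (sym (ι-fromℤ i)))

  -- Powers of -1 and ±3 against congruences for q

  [-1]^[2i]≈1 : ∀ {h} i → h ≡ 2 ℕ.* i → (- 1#) ^ h ≈ 1#
  [-1]^[2i]≈1 i ≡.refl = trans (sym (^-assocʳ (- 1#) 2 i)) (trans (^-congˡ i
    (solve 0 (:- con (+ 1) :* (:- con (+ 1) :* con (+ 1)) := con (+ 1)) refl)) (1^n≈1 i))

  [-1]^[1+2i]≈-1 : ∀ {h} i → h ≡ 1 ℕ.+ 2 ℕ.* i → (- 1#) ^ h ≈ - 1#
  [-1]^[1+2i]≈-1 i ≡.refl = trans (*-congˡ ([-1]^[2i]≈1 i ≡.refl)) (*-identityʳ _)

  [-3]^n≈ : ∀ n → -3# ^ n ≈ (- 1#) ^ n * (3 · 1#) ^ n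
  [-3]^n≈ n = trans (^-congˡ n (solve 0 (con -[1+ 2 ] := :- con (+ 1) :* con (+ 3)) refl)) (^-distrib-* (- 1#) (3 · 1#) n)

  Condition : Set (ℓ₁)
  Condition =
    ( (t F.≈ fromℤ F (+ 1) × (+ q) ≡ (+ 1) [mod + 4 ])
    ⊎ (t F.≈ fromℤ F (ℤ.- (+ 3)) ×
        ((+ q) ≡ (+ 1) [mod + 12 ] ⊎ (+ q) ≡ (ℤ.- (+ 1)) [mod + 12 ]))
    ⊎ (t F.≈ fromℤ F (+ 3) × (+ q) ≡ (ℤ.- (+ 1)) [mod + 6 ]))

  bijective⇒condition : Bijective _≈_ _≈_ f → Condition
  bijective⇒condition f-bijective with mod-2-cases q
  ... | inj₁ (h , q≡) = contradiction (prime-divisor·1≈0 2 prime[2] (divides h (≡.trans q≡ (ℕₚ.*-comm 2 h))))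
                          (PowerSums.even-impossible f-bijective)
  ... | inj₂ (h , q≡) = [ inj₁ ∘ case-1 , inj₂ ∘ [ inj₁ ∘ case-[-3] , inj₂ ∘ case-3 ]′ ]′ (τ-value f-bijective h q≡)
    where
    [-1]^h-cases : (∃[ i ] h ≡ 2 ℕ.* i × (- 1#) ^ h ≈ 1#) ⊎ (∃[ i ] h ≡ 1 ℕ.+ 2 ℕ.* i × (- 1#) ^ h ≈ - 1#)
    [-1]^h-cases = ⊎-map (λ (i , h≡) → i , h≡ , [-1]^[2i]≈1 i h≡) (λ (i , h≡) → i , h≡ , [-1]^[1+2i]≈-1 i h≡) (mod-2-cases h)

    1≉-1 : ¬ (1# ≈ - 1#)
    1≉-1 1≈-1 = 2≉0 h q≡ (trans (+-congˡ (+-identityʳ 1#)) (trans (+-congˡ 1≈-1) (-‿inverseʳ 1#)))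

    4∣q-1 : ∀ i → h ≡ 2 ℕ.* i → 4 ∣ suc (suc r)
    4∣q-1 i ≡.refl = divides i (≡.trans (ℕₚ.suc-injective q≡)
      (S.solve 1 (λ i → S.con 2 S.:* (S.con 2 S.:* i) S.:= i S.:* S.con 4) ≡.refl i))

    4∣q+1 : ∀ i → h ≡ 1 ℕ.+ 2 ℕ.* i → 4 ∣ q ℕ.+ 1
    4∣q+1 i ≡.refl = divides (suc i) (≡.trans (≡.cong (ℕ._+ 1) q≡)
      (S.solve 1 (λ i → S.con 1 S.:+ S.con 2 S.:* (S.con 1 S.:+ S.con 2 S.:* i) S.:+ S.con 1 S.:= (S.con 1 S.:+ i) S.:* S.con 4) ≡.refl i))

    2∣q+1 : 2 ∣ q ℕ.+ 1
    2∣q+1 = divides (suc h) (≡.trans (≡.cong (ℕ._+ 1) q≡)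
      (S.solve 1 (λ h → S.con 1 S.:+ S.con 2 S.:* h S.:+ S.con 1 S.:= (S.con 1 S.:+ h) S.:* S.con 2) ≡.refl h))

    3∣q-1 : ∀ j → q ≡ 1 ℕ.+ 3 ℕ.* j → 3 ∣ suc (suc r)
    3∣q-1 j q≡3j = divides j (≡.trans (ℕₚ.suc-injective q≡3j) (ℕₚ.*-comm 3 j))

    3∣q+1 : ∀ j → q ≡ 2 ℕ.+ 3 ℕ.* j → 3 ∣ q ℕ.+ 1
    3∣q+1 j q≡3j = divides (suc j) (≡.trans (≡.cong (ℕ._+ 1) q≡3j)
      (S.solve 1 (λ j → S.con 2 S.:+ S.con 3 S.:* j S.:+ S.con 1 S.:= (S.con 1 S.:+ j) S.:* S.con 3) ≡.refl j))

    -- In characteristic 3 both values of τ would be zero.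
    3∤q : τ ≈ 3 · 1# ⊎ τ ≈ -3# → ∀ j → q ≢ 3 ℕ.* j
    3∤q τ≈±3 j q≡3j = τ≉0 ([ (λ τ≈3 → trans τ≈3 3≈0) , (λ τ≈-3 → trans τ≈-3 (trans (-‿cong 3≈0) -0#≈0#)) ]′ τ≈±3)
      where
      3≈0 : 3 · 1# ≈ 0#
      3≈0 = prime-divisor·1≈0 3 (toWitness {a? = prime? 3} _) (divides j (≡.trans q≡3j (ℕₚ.*-comm 3 j)))

    case-1 : τ ≈ 1# × ¬ ((- 1#) ^ suc h ≈ 1#) → t F.≈ fromℤ F (+ 1) × (+ q) ≡ (+ 1) [mod + 4 ]
    case-1 (τ≈1 , [-1]^n≉1) = τ⇒t (+ 1) (trans τ≈1 (sym (×-homo-1 1#))) , go [-1]^h-cases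
      where
      go : _ → 4 ∣ suc (suc r)
      go (inj₁ (i , h≡ , _))     = 4∣q-1 i h≡
      go (inj₂ (i , h≡ , [-1]^h≈-1)) = contradiction
        (trans (*-congˡ [-1]^h≈-1) (solve 0 (:- con (+ 1) :* :- con (+ 1) := con (+ 1)) refl)) [-1]^n≉1

    -- From 3^h = 1 follows (-3)^h = (-1)^h. The left side detects q modulo 3 and the right side q
    -- modulo 4, so both residues are 1 or both are -1.
    case-[-3] : τ ≈ -3# × (3 · 1#) ^ h ≈ 1# →
      t F.≈ fromℤ F (ℤ.- (+ 3)) × ((+ q) ≡ (+ 1) [mod + 12 ] ⊎ (+ q) ≡ (ℤ.- (+ 1)) [mod + 12 ])
    case-[-3] (τ≈-3 , 3^h≈1) = τ⇒t -[1+ 2 ] τ≈-3 , go (mod-3-cases q) [-1]^h-cases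
      where
      [-3]^h≈[-1]^h : -3# ^ h ≈ (- 1#) ^ h
      [-3]^h≈[-1]^h = trans ([-3]^n≈ h) (trans (*-congˡ 3^h≈1) (*-identityʳ _))
      go : _ → _ → 12 ∣ suc (suc r) ⊎ 12 ∣ q ℕ.+ 1
      go (inj₁ (j , q≡3j)) _ = contradiction q≡3j (3∤q (inj₂ τ≈-3) j)
      go (inj₂ (inj₁ (j , q≡3j))) (inj₁ (i , h≡ , _)) = inj₁ (lcm-least (4∣q-1 i h≡) (3∣q-1 j q≡3j))
      go (inj₂ (inj₁ (j , q≡3j))) (inj₂ (i , h≡ , [-1]^h≈-1)) = contradiction
        (trans (sym ([-3]^h≈1 h j q≡ q≡3j)) (trans [-3]^h≈[-1]^h [-1]^h≈-1)) 1≉-1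
      go (inj₂ (inj₂ (j , q≡3j))) (inj₁ (i , h≡ , [-1]^h≈1)) = contradiction
        (trans (sym [-1]^h≈1) (trans (sym [-3]^h≈[-1]^h) ([-3]^h≈-1 h j q≡ q≡3j))) 1≉-1
      go (inj₂ (inj₂ (j , q≡3j))) (inj₂ (i , h≡ , _)) = inj₂ (lcm-least (4∣q+1 i h≡) (3∣q+1 j q≡3j))

    -- The sign of (-3)^h selects q ≡ -1 modulo 3, and q is odd already.
    case-3 : τ ≈ 3 · 1# × -3# ^ h ≈ - 1# → t F.≈ fromℤ F (+ 3) × (+ q) ≡ (ℤ.- (+ 1)) [mod + 6 ]
    case-3 (τ≈3 , -3^h≈-1) = τ⇒t (+ 3) τ≈3 , go (mod-3-cases q)
      where
      go : _ → 6 ∣ q ℕ.+ 1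
      go (inj₁ (j , q≡3j)) = contradiction q≡3j (3∤q (inj₁ τ≈3) j)
      go (inj₂ (inj₁ (j , q≡3j))) = contradiction (trans (sym ([-3]^h≈1 h j q≡ q≡3j)) -3^h≈-1) 1≉-1
      go (inj₂ (inj₂ (j , q≡3j))) = lcm-least 2∣q+1 (3∣q+1 j q≡3j)

  -- For q ≡ ±1 modulo 12 the h-th powers of -3 and of -1 are the same sign u, and 3 is the product
  -- of the two bases.
  3^h≈ : ∀ h {u} → -3# ^ h ≈ u → (- 1#) ^ h ≈ u → u * u ≈ 1# → (3 · 1#) ^ h ≈ 1#
  3^h≈ h {u} [-3]^h≈u [-1]^h≈u u²≈1 = begin
    (3 · 1#) ^ h                 ≈⟨ ^-congˡ h (solve 0 (con (+ 3) := :- con (+ 1) :* con -[1+ 2 ]) refl) ⟩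
    (- 1# * -3#) ^ h             ≈⟨ ^-distrib-* (- 1#) -3# h ⟩
    (- 1#) ^ h * -3# ^ h         ≈⟨ *-cong [-1]^h≈u [-3]^h≈u ⟩
    u * u                        ≈⟨ u²≈1 ⟩
    1#                           ∎

  condition⇒bijective : Condition → Bijective _≈_ _≈_ f
  condition⇒bijective (inj₁ (t≈1 , divides i q-1≡)) =
    τ≈1⇒bijective (2 ℕ.* i) (≡.trans (≡.cong suc q-1≡)
        (S.solve 1 (λ i → S.con 1 S.:+ i S.:* S.con 4 S.:= S.con 1 S.:+ S.con 2 S.:* (S.con 2 S.:* i)) ≡.refl i))
      ([-1]^[2i]≈1 i ≡.refl) (trans (t⇒τ (+ 1) t≈1) (×-homo-1 1#))
  condition⇒bijective (inj₂ (inj₁ (t≈-3 , inj₁ (divides i q-1≡)))) =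
    τ≈-3⇒bijective h q≡ (3^h≈ h
      ([-3]^h≈1 h (4 ℕ.* i) q≡ (≡.trans (≡.cong suc q-1≡)
        (S.solve 1 (λ i → S.con 1 S.:+ i S.:* S.con 12 S.:= S.con 1 S.:+ S.con 3 S.:* (S.con 4 S.:* i)) ≡.refl i)))
      ([-1]^[2i]≈1 (3 ℕ.* i) ≡.refl) (*-identityˡ 1#)) (t⇒τ -[1+ 2 ] t≈-3)
    where
    h = 2 ℕ.* (3 ℕ.* i)
    q≡ : q ≡ 1 ℕ.+ 2 ℕ.* h
    q≡ = ≡.trans (≡.cong suc q-1≡)
      (S.solve 1 (λ i → S.con 1 S.:+ i S.:* S.con 12 S.:= S.con 1 S.:+ S.con 2 S.:* (S.con 2 S.:* (S.con 3 S.:* i))) ≡.refl i)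
  -- The quotient is a successor because q + 1 is positive; thus q = 11 + 12 i and h = 5 + 6 i.
  condition⇒bijective (inj₂ (inj₁ (t≈-3 , inj₂ (divides (suc i) q+1≡)))) =
    τ≈-3⇒bijective h q≡ (3^h≈ h
      ([-3]^h≈-1 h (3 ℕ.+ 4 ℕ.* i) q≡ (ℕₚ.+-cancelʳ-≡ 1 q _ (≡.trans q+1≡
        (S.solve 1 (λ i → (S.con 1 S.:+ i) S.:* S.con 12 S.:= S.con 2 S.:+ S.con 3 S.:* (S.con 3 S.:+ S.con 4 S.:* i) S.:+ S.con 1) ≡.refl i))))
      ([-1]^[1+2i]≈-1 (2 ℕ.+ 3 ℕ.* i) ≡.refl)
      (solve 0 (:- con (+ 1) :* :- con (+ 1) := con (+ 1)) refl)) (t⇒τ -[1+ 2 ] t≈-3)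
    where
    h = 1 ℕ.+ 2 ℕ.* (2 ℕ.+ 3 ℕ.* i)
    q≡ : q ≡ 1 ℕ.+ 2 ℕ.* h
    q≡ = ℕₚ.+-cancelʳ-≡ 1 q _ (≡.trans q+1≡
      (S.solve 1 (λ i → (S.con 1 S.:+ i) S.:* S.con 12 S.:= S.con 1 S.:+ S.con 2 S.:* (S.con 1 S.:+ S.con 2 S.:* (S.con 2 S.:+ S.con 3 S.:* i)) S.:+ S.con 1) ≡.refl i))
  condition⇒bijective (inj₂ (inj₂ (t≈3 , divides (suc i) q+1≡))) =
    τ≈3⇒bijective h q≡
      ([-3]^h≈-1 h (1 ℕ.+ 2 ℕ.* i) q≡ (ℕₚ.+-cancelʳ-≡ 1 q _ (≡.trans q+1≡
        (S.solve 1 (λ i → (S.con 1 S.:+ i) S.:* S.con 6 S.:= S.con 2 S.:+ S.con 3 S.:* (S.con 1 S.:+ S.con 2 S.:* i) S.:+ S.con 1) ≡.refl i))))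
      (t⇒τ (+ 3) t≈3)
    where
    h = 2 ℕ.+ 3 ℕ.* i
    q≡ : q ≡ 1 ℕ.+ 2 ℕ.* h
    q≡ = ℕₚ.+-cancelʳ-≡ 1 q _ (≡.trans q+1≡
      (S.solve 1 (λ i → (S.con 1 S.:+ i) S.:* S.con 6 S.:= S.con 1 S.:+ S.con 2 S.:* (S.con 2 S.:+ S.con 3 S.:* i) S.:+ S.con 1) ≡.refl i))

open import Data.Nat.Base using (_^_)
open import Data.Integer.Base using (-_)

theorem1p1 : ∀ {c₁ ℓ₁ c₂ ℓ₂} (q : ℕ) → q > 2 → PrimePower q →
    (F : Field c₁ ℓ₁) → HasCardinality F q →
    (K : Field c₂ ℓ₂) → HasCardinality K (q ^ 2) →
    (ι : Field.Carrier F → Field.Carrier K) → IsFieldEmbedding F K ι →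
    (t : Field.Carrier F) → ¬ (Field._≈_ F t (Field.0# F)) →
    IsPermutationPolynomial K (extendScalars F K ι (binomial F q t))
    ⇔
    ( (Field._≈_ F t (fromℤ F (+ 1)) × (+ q) ≡ (+ 1) [mod + 4 ])
    ⊎ (Field._≈_ F t (fromℤ F (- (+ 3))) ×
    ((+ q) ≡ (+ 1) [mod + 12 ] ⊎ (+ q) ≡ (- (+ 1)) [mod + 12 ]))
    ⊎ (Field._≈_ F t (fromℤ F (+ 3)) × (+ q) ≡ (- (+ 1)) [mod + 6 ]))
theorem1p1 (suc (suc (suc r))) _ (p , k , p-prime , _ , q≡p^k) F F-card K K-card ι ι-embedding t t≉0 =
  mk⇔ bijective⇒condition condition⇒bijective
  where open Equivalence r p k p-prime q≡p^k F F-card K K-card ι ι-embedding t t≉0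
theorem1p1 (suc zero)       (s≤s ())
theorem1p1 (suc (suc zero)) (s≤s (s≤s ()))
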